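{- Every 6-balanced looped simple graph $G=(V,E,L)$ is rigid as a linearly constrained framework in $\mathbb{R}^2$.
   Context: A looped simple graph $G=(V,E,L)$ consists of a finite vertex set $V$, a set $E$ of edges forming a simple graph on $V$, and a set $L$ of loops, each incident with one vertex (multiple loops at a vertex allowed). $G$ is $k$-balanced if for every $T\subseteq V$ with $|T|\le k$, every connected component of $G-T$ (delete the vertices of $T$ together with all incident edges and loops) has at least $k-|T|$ vertices incident with loops. For $p:V\to\mathbb{R}^2$, $q:L\to\mathbb{R}^2$, the rigidity matrix $R(G,p,q)$ is the $(|E|+|L|)\times 2|V|$ matrix with two columns per vertex, where the row of an edge $uv$ has $p(u)-p(v)$ in the columns of $u$, $p(v)-p(u)$ in the columns of $v$, zeros elsewhere, and the row of a loop $l$ at $v$ has $q(l)$ in the columns of $v$, zeros elsewhere. $G$ is rigid as a linearly constrained framework in $\mathbb{R}^2$ if $\operatorname{rank} R(G,p,q)=2|V|$ for some (equivalently, for generic, i.e. with coordinates algebraically independent over $\mathbb{Q}$) $(p,q)$. -}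

module Defs where

open import Data.Nat using (ℕ; _≤_; _∸_)
open import Data.Bool using (Bool; true; false)
open import Data.Fin using (Fin)
open import Data.Fin.Subset using (Subset; _∈_; _∉_; ∣_∣)
open import Data.Product using (Σ; ∃; _×_; _,_)
open import Data.Rational using (ℚ; _+_; _-_; _*_; 0ℚ)
open import Relation.Binary.PropositionalEquality using (_≡_)
open import Relation.Binary.Construct.Closure.ReflexiveTransitive using (Star)

-- A looped simple graph G = (V, E, L) with V = Fin n.
-- E : a simple graph, given by a symmetric irreflexive adjacency relation.
-- L : m loops, loop l is incident with vertex loopAt l (several loops may
--     share a vertex).
record LoopedGraph : Set where
  field
    n      : ℕ
    adj    : Fin n → Fin n → Bool
    symm   : ∀ u v → adj u v ≡ adj v u
    irrefl : ∀ v → adj v v ≡ false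
    m      : ℕ
    loopAt : Fin m → Fin n

open LoopedGraph public

HasLoop : (G : LoopedGraph) → Fin (n G) → Set
HasLoop G v = ∃ λ (l : Fin (m G)) → loopAt G l ≡ v

StepIn : (G : LoopedGraph) → Subset (n G) → Fin (n G) → Fin (n G) → Set
StepIn G T u v = u ∉ T × v ∉ T × adj G u v ≡ true

Connected : (G : LoopedGraph) → Subset (n G) → Fin (n G) → Fin (n G) → Set
Connected G T u v = Star (StepIn G T) u v

-- G is k-balanced: for every T ⊆ V with |T| ≤ k, every connected component
-- of G - T (= the component of some vertex v ∉ T) contains at least k - |T|
-- vertices incident with loops.
Balanced : ℕ → LoopedGraph → Set
Balanced k G =
  (T : Subset (n G)) → ∣ T ∣ ≤ k →
  (v : Fin (n G)) → v ∉ T →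
  Σ (Subset (n G)) λ S →
    (k ∸ ∣ T ∣ ≤ ∣ S ∣) ×
    (∀ w → w ∈ S → w ∉ T × Connected G T v w × HasLoop G w)

Pt : Set
Pt = ℚ × ℚ

_⊖_ : Pt → Pt → Pt
(a , b) ⊖ (c , d) = (a - c , b - d)

_·_ : Pt → Pt → ℚ
(a , b) · (c , d) = a * c + b * d

origin : Pt
origin = (0ℚ , 0ℚ)

-- x ∈ ℚ^{2|V|} (two coordinates per vertex) lies in the kernel of the
-- rigidity matrix R(G,p,q): every edge row and every loop row gives 0.
InKernel : (G : LoopedGraph) → (Fin (n G) → Pt) → (Fin (m G) → Pt) →
           (Fin (n G) → Pt) → Set
InKernel G p q x =
  (∀ u v → adj G u v ≡ true →
     ((p u ⊖ p v) · x u) + ((p v ⊖ p u) · x v) ≡ 0ℚ) ×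
  (∀ l → (q l · x (loopAt G l)) ≡ 0ℚ)

-- rank R(G,p,q) = 2|V|, i.e. R(G,p,q) has full column rank, i.e. its
-- kernel is trivial.
FullRank : (G : LoopedGraph) → (Fin (n G) → Pt) → (Fin (m G) → Pt) → Set
FullRank G p q = ∀ x → InKernel G p q x → ∀ v → x v ≡ origin

Rigid : LoopedGraph → Set
Rigid G = ∃ λ (p : Fin (n G) → Pt) → ∃ λ (q : Fin (m G) → Pt) → FullRank G p q

{-# OPTIONS --safe #-}
module Submission where

-- Consider lists of rows taken from all edges of the complete graph, the loops, and unit "pins"
-- at vertices. If (p , q) does not have full rank, a small perturbation makes some dependent list
-- independent while every independent list of length at most 2|V| stays independent; this can
-- happen only finitely often.
--
-- For the perturbation, take x ≠ 0 in the kernel of R(G,p,q), let Z be its zero set, and put two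
-- vertices in a common class if x agrees on them with one infinitesimal rigid motion. Let H
-- consist of two pins at each vertex of Z, one loop at each looped vertex outside Z, and a
-- triangulation of each class other than Z. All rows of H kill x, and a discharging argument from
-- 6-balancedness shows |H| ≥ 2|V|, so H carries a stress ω. If no first-order perturbation removes
-- a minimal such ω, then ω vanishes on loops and Σ ω(uv) (x(u) − x(v)) = 0 at every vertex. Since
-- x(u) − x(v) is p(u) − p(v) rotated by a right angle and scaled by the angular velocity λ of the
-- class of uv, λω is again a stress, so λ is constant on the support of ω. Classes with equal λ
-- are disjoint, so ω is a sum of stresses of triangulations, which are independent in general
-- position: ω = 0, a contradiction.

open import Defs
open import Data.Bool using (Bool; true; false; T; not; _∧_; if_then_else_) renaming (_≟_ to _≟B_)
open import Data.Empty using (⊥; ⊥-elim)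
open import Data.Fin using (Fin; zero; suc; toℕ; _↑ˡ_; _↑ʳ_; splitAt; punchIn; punchOut)
open import Data.Fin.Properties using (any?; all?; ¬∀⟶∃¬; punchIn-punchOut; toℕ-injective; splitAt-↑ˡ; splitAt-↑ʳ) renaming (_≟_ to _≟F_)
open import Data.List using (List; []; _∷_; _++_; length; lookup; map; filter; concatMap; cartesianProduct; cartesianProductWith; deduplicate; take; allFin; tabulate)
open import Data.List.Properties using (length-++; length-map; length-take; length-tabulate)
open import Data.List.Membership.Propositional using (_∈_)
open import Data.List.Membership.Propositional.Properties using (∈-++⁺ˡ; ∈-++⁺ʳ; ∈-++⁻; ∈-allFin; ∈-map⁺; ∈-map⁻; ∈-filter⁺; ∈-filter⁻; ∈-deduplicate⁺; ∈-deduplicate⁻; ∈-cartesianProduct⁺; ∈-cartesianProductWith⁺; ∈-lookup)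
open import Data.List.Relation.Unary.All as All using (All; []; _∷_)
open import Data.List.Relation.Unary.AllPairs as AllPairs using (AllPairs; []; _∷_)
import Data.List.Relation.Unary.AllPairs.Properties as AllPairsP
open import Data.List.Relation.Unary.Any using (here; there; index)
open import Data.List.Relation.Unary.Any.Properties using (lookup-index)
open import Data.List.Relation.Unary.Unique.Propositional using (Unique)
import Data.List.Relation.Unary.Unique.Propositional.Properties as UniqueP
import Data.List.Relation.Unary.Unique.DecPropositional.Properties as DecUniqueP
import Data.Nat.Properties as ℕP
open import Data.Product using (Σ; ∃; _×_; _,_; proj₁; proj₂; uncurry)
open import Data.Product.Properties using (≡-dec)
open import Data.Sum as Sum using (_⊎_; inj₁; inj₂; [_,_]′)
open import Function using (_∘_; id)
open import Relation.Binary.PropositionalEquality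
open import Relation.Nullary using (¬_; Dec; yes; no; does; contradiction; ¬?; _×-dec_)
open import Relation.Nullary.Decidable using (dec-true; dec-false; map′)

-- The number six: count every row as two halves. A triangulated class of s vertices has 2s - 3
-- edges, so 4s - 6 halves, whereas each vertex outside Z must collect four. A class is thus six
-- halves short. Members that lie in Z, have a loop or lie in a second class make do with at most
-- three halves from this class. If some member has no such resource, deleting the resourceful
-- members cuts off a component without loops, so 6-balancedness provides at least six of them, and
-- each gives up one half.
--
-- The edges of H need not be edges of G, which is why independence is tracked for all pairs of
-- vertices.
--
-- Since x kills every row of H, a relation of the perturbed rows has no constant term when paired
-- with x. One number, the sum of the ω-weighted perturbed rows evaluated at x, therefore decides
-- whether the first order already destroys the relation.
--
-- All positions are rational, so genericity is never available. Its substitute is a short list of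
-- open conditions (distinct first coordinates, no three points collinear) that survive small moves.

module Counting where
  open import Data.Fin.Subset as Sub using (Subset; ∣_∣; ⁅_⁆)
  open import Data.Fin.Subset.Properties using (p⊆q⇒∣p∣≤∣q∣; ∣⁅x⁆∣≡1; ∣⊥∣≡0; x∈⁅x⁆)
  open import Data.Nat using (ℕ; zero; suc; z≤n; s≤s; _+_; _*_; _∸_; _≤_; _<_; _≤ᵇ_; _≤?_)
  open import Data.Nat.Properties using (≤-trans; ≤-refl; +-mono-≤; module ≤-Reasoning)
  open import Data.Nat.Tactic.RingSolver using (solve-∀)
  import Data.Vec as Vec
  open import Data.Vec.Properties using (lookup∘tabulate; []=⇒lookup; lookup⇒[]=)
  open import Relation.Binary.Construct.Closure.ReflexiveTransitive using (ε; _◅_)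

  private variable
    A B : Set

  -- Sums of natural numbers over lists

  select : (A → Bool) → List A → List A
  select b = filter (λ x → b x ≟B true)

  ∑ : List A → (A → ℕ) → ℕ
  ∑ []       f = 0
  ∑ (x ∷ xs) f = f x + ∑ xs f

  𝟙 : Bool → ℕ
  𝟙 true  = 1
  𝟙 false = 0

  ∑-mono : ∀ (xs : List A) {f g : A → ℕ} → (∀ {x} → x ∈ xs → f x ≤ g x) → ∑ xs f ≤ ∑ xs g
  ∑-mono []       h = z≤n
  ∑-mono (x ∷ xs) h = +-mono-≤ (h (here refl)) (∑-mono xs (h ∘ there))

  ∑-cong : ∀ (xs : List A) {f g : A → ℕ} → (∀ x → f x ≡ g x) → ∑ xs f ≡ ∑ xs g
  ∑-cong []       h = refl
  ∑-cong (x ∷ xs) h = cong₂ _+_ (h x) (∑-cong xs h)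

  ∑-+ : ∀ (xs : List A) (f g : A → ℕ) → ∑ xs (λ x → f x + g x) ≡ ∑ xs f + ∑ xs g
  ∑-+ []       f g = refl
  ∑-+ (x ∷ xs) f g = trans (cong (f x + g x +_) (∑-+ xs f g)) (lemma (f x) (g x) (∑ xs f) (∑ xs g))
    where
    lemma : ∀ a b c d → a + b + (c + d) ≡ a + c + (b + d)
    lemma = solve-∀

  ∑-* : ∀ (xs : List A) c (f : A → ℕ) → ∑ xs (λ x → c * f x) ≡ c * ∑ xs f
  ∑-* []       c f = sym (ℕP.*-zeroʳ c)
  ∑-* (x ∷ xs) c f = trans (cong (c * f x +_) (∑-* xs c f)) (sym (ℕP.*-distribˡ-+ c (f x) (∑ xs f)))

  ∑-zero : ∀ (xs : List A) → ∑ xs (λ _ → 0) ≡ 0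
  ∑-zero []       = refl
  ∑-zero (x ∷ xs) = ∑-zero xs

  ∑-swap : ∀ (xs : List A) (ys : List B) (f : A → B → ℕ) →
    ∑ xs (λ x → ∑ ys (f x)) ≡ ∑ ys (λ y → ∑ xs (λ x → f x y))
  ∑-swap []       ys f = sym (∑-zero ys)
  ∑-swap (x ∷ xs) ys f = trans (cong (∑ ys (f x) +_) (∑-swap xs ys f)) (sym (∑-+ ys (f x) _))

  ∑-++ : ∀ (xs ys : List A) f → ∑ (xs ++ ys) f ≡ ∑ xs f + ∑ ys f
  ∑-++ []       ys f = refl
  ∑-++ (x ∷ xs) ys f = trans (cong (f x +_) (∑-++ xs ys f)) (sym (ℕP.+-assoc (f x) _ _))

  ∑-select : ∀ b (xs : List A) f → ∑ (select b xs) f ≡ ∑ xs (λ x → 𝟙 (b x) * f x)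
  ∑-select b []       f = refl
  ∑-select b (x ∷ xs) f with b x
  ... | true  = cong₂ _+_ (sym (ℕP.+-identityʳ (f x))) (∑-select b xs f)
  ... | false = ∑-select b xs f

  ∑-partition : ∀ b (xs : List A) f → ∑ (select b xs) f + ∑ (select (not ∘ b) xs) f ≡ ∑ xs f
  ∑-partition b []       f = refl
  ∑-partition b (x ∷ xs) f with b x
  ... | true  = trans (ℕP.+-assoc (f x) _ _) (cong (f x +_) (∑-partition b xs f))
  ... | false = trans (lemma (∑ (select b xs) f) (f x) _) (cong (f x +_) (∑-partition b xs f))
    where
    lemma : ∀ a b c → a + (b + c) ≡ b + (a + c)
    lemma = solve-∀

  length≡∑ : ∀ (xs : List A) → length xs ≡ ∑ xs (λ _ → 1)
  length≡∑ []       = refl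
  length≡∑ (x ∷ xs) = cong suc (length≡∑ xs)

  length-select : ∀ b (xs : List A) → length (select b xs) ≡ ∑ xs (𝟙 ∘ b)
  length-select b xs = trans (length≡∑ (select b xs)) (trans (∑-select b xs _) (∑-cong xs λ x → ℕP.*-identityʳ (𝟙 (b x))))

  length-concatMap : ∀ (f : A → List B) xs → length (concatMap f xs) ≡ ∑ xs (length ∘ f)
  length-concatMap f []       = refl
  length-concatMap f (x ∷ xs) = trans (length-++ (f x)) (cong (length (f x) +_) (length-concatMap f xs))

  term≤∑ : ∀ {xs : List A} {x} f → x ∈ xs → f x ≤ ∑ xs f
  term≤∑ f (here refl) = ℕP.m≤m+n _ _
  term≤∑ {xs = y ∷ _} f (there x∈) = ≤-trans (term≤∑ f x∈) (ℕP.m≤n+m _ (f y))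

  ∑-mono-< : ∀ {xs : List A} {x} {f g : A → ℕ} → x ∈ xs → f x < g x → (∀ {y} → y ∈ xs → f y ≤ g y) → ∑ xs f < ∑ xs g
  ∑-mono-< {xs = _ ∷ xs} (here refl) lt h = +-mono-≤ lt (∑-mono xs (h ∘ there))
  ∑-mono-< {xs = _ ∷ _}  (there x∈)  lt h =
    ≤-trans (ℕP.≤-reflexive (sym (ℕP.+-suc _ _))) (+-mono-≤ (h (here refl)) (∑-mono-< x∈ lt (h ∘ there)))

  length≤1⇒≡ : ∀ {xs : List A} {x y} → length xs ≤ 1 → x ∈ xs → y ∈ xs → x ≡ y
  length≤1⇒≡ {xs = _ ∷ []}    _ (here refl) (here refl) = refl
  length≤1⇒≡ {xs = _ ∷ _ ∷ _} (s≤s ()) _ _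

  ∣tabulate∣ : ∀ {k} (f : Fin k → Bool) → ∣ Vec.tabulate f ∣ ≡ ∑ (allFin k) (𝟙 ∘ f)
  ∣tabulate∣ f = go f id
    where
    go : ∀ {k} {A : Set} (f : A → Bool) (g : Fin k → A) → ∣ Vec.tabulate (f ∘ g) ∣ ≡ ∑ (tabulate g) (𝟙 ∘ f)
    go {zero}  f g = refl
    go {suc k} f g with f (g zero)
    ... | true  = cong suc (go f (g ∘ suc))
    ... | false = go f (g ∘ suc)

  ∈tabulate⁺ : ∀ {k} (f : Fin k → Bool) {i} → f i ≡ true → i Sub.∈ Vec.tabulate f
  ∈tabulate⁺ f {i} e = lookup⇒[]= i _ (trans (lookup∘tabulate f i) e)

  ∈tabulate⁻ : ∀ {k} (f : Fin k → Bool) {i} → i Sub.∈ Vec.tabulate f → f i ≡ true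
  ∈tabulate⁻ f {i} i∈ = trans (sym (lookup∘tabulate f i)) ([]=⇒lookup i∈)

  ∧-true : ∀ {a b} → a ∧ b ≡ true → a ≡ true × b ≡ true
  ∧-true {true} e = refl , e

  T⇒true : ∀ {a} → T a → a ≡ true
  T⇒true {true} _ = refl

  not-true : ∀ {a} → not a ≡ true → a ≡ false
  not-true {false} _ = refl

  -- A class of s vertices owns triangulated s edges of H, of which it hands charge (s − 1)
  -- halves to each of its vertices (but four halves to a bad vertex, see share).
  triangulated : ℕ → ℕ
  triangulated (suc (suc t)) = suc (t + t)
  triangulated _             = 0

  charge : ℕ → ℕ
  charge 0 = 0
  charge 1 = 1
  charge 2 = 2
  charge 3 = 2
  charge 4 = 2
  charge (suc (suc (suc (suc (suc _))))) = 3

  charge≤3 : ∀ a → charge a ≤ 3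
  charge≤3 0 = z≤n
  charge≤3 1 = s≤s z≤n
  charge≤3 2 = s≤s (s≤s z≤n)
  charge≤3 3 = s≤s (s≤s z≤n)
  charge≤3 4 = s≤s (s≤s z≤n)
  charge≤3 (suc (suc (suc (suc (suc _))))) = ≤-refl

  1≤charge : ∀ a → 1 ≤ charge (suc a)
  1≤charge 0 = ≤-refl
  1≤charge 1 = s≤s z≤n
  1≤charge 2 = s≤s z≤n
  1≤charge 3 = s≤s z≤n
  1≤charge (suc (suc (suc (suc _)))) = s≤s z≤n

  2≤charge : ∀ a → 2 ≤ charge (suc (suc a))
  2≤charge 0 = ≤-refl
  2≤charge 1 = ≤-refl
  2≤charge 2 = ≤-refl
  2≤charge (suc (suc (suc _))) = s≤s (s≤s z≤n)

  charge-≥5 : ∀ {a} → 5 ≤ a → charge a ≡ 3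
  charge-≥5 (s≤s (s≤s (s≤s (s≤s (s≤s _))))) = refl

  -- Subadditivity allows the neighbours of a vertex to be counted class by class: spreading them
  -- over several classes never lowers the total charge.
  charge-+ : ∀ a b → charge (a + b) ≤ charge a + charge b
  charge-+ 0 b = ≤-refl
  charge-+ 1 0 = ≤-refl
  charge-+ 1 1 = ≤-refl
  charge-+ 1 2 = s≤s (s≤s z≤n)
  charge-+ 1 3 = s≤s (s≤s z≤n)
  charge-+ 1 4 = ≤-refl
  charge-+ 1 (suc (suc (suc (suc (suc b))))) = s≤s (s≤s (s≤s z≤n))
  charge-+ (suc (suc a)) zero = ≤-trans (ℕP.≤-reflexive (cong charge (ℕP.+-identityʳ (suc (suc a))))) (ℕP.m≤m+n _ 0)
  charge-+ (suc (suc a)) (suc b) = ≤-trans (charge≤3 (suc (suc a) + suc b)) (+-mono-≤ (2≤charge a) (1≤charge b))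

  charge-∑ : ∀ (xs : List A) f → charge (∑ xs f) ≤ ∑ xs (charge ∘ f)
  charge-∑ []       f = z≤n
  charge-∑ (x ∷ xs) f = ≤-trans (charge-+ (f x) (∑ xs f)) (ℕP.+-monoʳ-≤ (charge (f x)) (charge-∑ xs f))

  -- This serves an unlooped vertex with six neighbours spread over two classes: a split 1 and 5
  -- pays 1 + 3, and any other split pays at least 2 on both sides.
  charge-pair : ∀ {a b} → 1 ≤ a → 1 ≤ b → 6 ≤ a + b → 4 ≤ charge a + charge b
  charge-pair {suc zero} {b} _ _ (s≤s 5≤b) = ℕP.≤-reflexive (cong suc (sym (charge-≥5 5≤b)))
  charge-pair {suc (suc a)} {suc zero} _ _ h =
    +-mono-≤ (ℕP.≤-reflexive (sym (charge-≥5 {suc (suc a)} (ℕP.+-cancelʳ-≤ 1 5 (suc (suc a)) h)))) ≤-refl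
  charge-pair {suc (suc a)} {suc (suc b)} _ _ _ = +-mono-≤ (2≤charge a) (2≤charge b)

  charge-list : ∀ (xs : List A) f → 1 < length xs → (∀ {x} → x ∈ xs → 1 ≤ f x) → 6 ≤ ∑ xs f → 4 ≤ ∑ xs (charge ∘ f)
  charge-list (x ∷ y ∷ xs) f _ h 6≤ =
    ≤-trans (charge-pair (h (here refl)) (≤-trans (h (there (here refl))) (ℕP.m≤m+n _ _)) 6≤)
      (ℕP.+-monoʳ-≤ (charge (f x)) (charge-∑ (y ∷ xs) f))
  charge-list (x ∷ []) f (s≤s ()) _ _

  -- Dividing the 4s - 6 halves of a class evenly gives 4 - 6/s per member; `charge (s ∸ 1)` is the
  -- integer part of this for s ≥ 2, with the cap 3 reached at s = 6.
  charge-class : ∀ s → charge (s ∸ 1) * s ≤ 2 * triangulated s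
  charge-class 0 = z≤n
  charge-class 1 = z≤n
  charge-class 2 = ≤-refl
  charge-class 3 = ≤-refl
  charge-class 4 = ℕP.m≤m+n 8 2
  charge-class 5 = ℕP.m≤m+n 10 4
  charge-class (suc (suc (suc (suc (suc (suc t)))))) = ≤-trans (ℕP.m≤m+n _ t) (ℕP.≤-reflexive (lemma t))
    where
    lemma : ∀ t → 3 * (6 + t) + t ≡ 2 * (1 + ((4 + t) + (4 + t)))
    lemma = solve-∀

  -- Here 4(d + g) - 6 halves are available and 4d + 3g are handed out, which is possible exactly
  -- because g ≥ 6.
  charge-class-bad : ∀ d g → 6 ≤ g → 4 * d + 3 * g ≤ 2 * triangulated (d + g)
  charge-class-bad d (suc (suc (suc (suc (suc (suc g)))))) (s≤s (s≤s (s≤s (s≤s (s≤s (s≤s _)))))) =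
    ≤-trans (ℕP.m≤m+n _ g) (ℕP.≤-reflexive (trans (lemma d g) (cong (λ z → 2 * triangulated z) (sym (lemma' d g)))))
    where
    lemma : ∀ d g → 4 * d + 3 * (6 + g) + g ≡ 2 * (1 + ((4 + (d + g)) + (4 + (d + g))))
    lemma = solve-∀
    lemma' : ∀ d g → d + (6 + g) ≡ 6 + (d + g)
    lemma' = solve-∀

  -- Discharging: the rows of `H` number at least twice the vertices

  module Discharging
    (G : LoopedGraph) (bal : Balanced 6 G) (isZ : Fin (n G) → Bool)
    {Class : Set} (𝒞 : List Class) (mem : Class → Fin (n G) → Bool)
    (edge-class : ∀ {u v} → adj G u v ≡ true → isZ u ≡ false → ∃ λ κ → κ ∈ 𝒞 × mem κ u ≡ true × mem κ v ≡ true)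
    (other-member : ∀ {κ v} → κ ∈ 𝒞 → mem κ v ≡ true → ∃ λ w → w ≢ v × mem κ w ≡ true)
    where

    looped : Fin (n G) → Bool
    looped v = does (any? λ l → loopAt G l ≟F v)

    -- The list `vertices` has the zero vertices in front. Members of a class inherit this order, so
    -- a member in Z can only be the first vertex of a triangulation.
    zeros nonzeros vertices : List (Fin (n G))
    zeros    = select isZ (allFin (n G))
    nonzeros = select (not ∘ isZ) (allFin (n G))
    vertices = zeros ++ nonzeros

    ∑-vertices : ∀ f → ∑ vertices f ≡ ∑ (allFin (n G)) f
    ∑-vertices f = trans (∑-++ zeros nonzeros f) (∑-partition isZ (allFin (n G)) f)

    ∈-vertices : ∀ v → v ∈ vertices
    ∈-vertices v with isZ v in e
    ... | true  = ∈-++⁺ˡ (∈-filter⁺ _ (∈-allFin v) e)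
    ... | false = ∈-++⁺ʳ zeros (∈-filter⁺ _ (∈-allFin v) (cong not e))

    members : Class → List (Fin (n G))
    members κ = select (mem κ) vertices

    size : Class → ℕ
    size κ = length (members κ)

    classesAt : Fin (n G) → List Class
    classesAt v = select (λ κ → mem κ v) 𝒞

    -- A vertex with a single source of rows: no pins, no loop, at most one class. The uniform
    -- charge of at most 3 cannot pay its 4 halves.
    bad : Fin (n G) → Bool
    bad v = not (isZ v) ∧ (not (looped v) ∧ (length (classesAt v) ≤ᵇ 1))

    others : Class → Fin (n G) → Fin (n G) → Bool
    others κ v w = mem κ w ∧ not (does (w ≟F v))

    others<size : ∀ {κ v} → mem κ v ≡ true → ∑ vertices (𝟙 ∘ others κ v) < size κ
    others<size {κ} {v} κ∋v = subst (∑ vertices (𝟙 ∘ others κ v) <_) (sym (length-select (mem κ) vertices))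
      (∑-mono-< (∈-vertices v) strict (λ {w} _ → weak w))
      where
      strict : 𝟙 (others κ v v) < 𝟙 (mem κ v)
      strict rewrite κ∋v | dec-true (v ≟F v) refl = s≤s z≤n
      weak : ∀ w → 𝟙 (others κ v w) ≤ 𝟙 (mem κ w)
      weak w with mem κ w | does (w ≟F v)
      ... | false | _     = z≤n
      ... | true  | true  = z≤n
      ... | true  | false = ≤-refl

    others-true : ∀ {κ v w} → mem κ w ≡ true → w ≢ v → others κ v w ≡ true
    others-true {v = v} {w} κ∋w w≢v rewrite κ∋w | dec-false (w ≟F v) w≢v = refl

    1≤size∸1 : ∀ {κ v} → κ ∈ 𝒞 → mem κ v ≡ true → 1 ≤ size κ ∸ 1
    1≤size∸1 {κ} {v} κ∈ κ∋v with other-member κ∈ κ∋v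
    ... | w , w≢v , κ∋w = ≤-trans
      (subst (λ b → 𝟙 b ≤ ∑ vertices (𝟙 ∘ others κ v)) (others-true κ∋w w≢v) (term≤∑ (𝟙 ∘ others κ v) (∈-vertices w)))
      (ℕP.∸-monoˡ-≤ 1 (others<size κ∋v))

    -- Every neighbour shares a class with v, and a class accounts for at most its members other
    -- than v.
    degree≤ : ∀ v → isZ v ≡ false → ∣ Vec.tabulate (adj G v) ∣ ≤ ∑ (classesAt v) (λ κ → size κ ∸ 1)
    degree≤ v v∉Z = begin
      ∣ Vec.tabulate (adj G v) ∣                              ≡⟨ ∣tabulate∣ (adj G v) ⟩
      ∑ (allFin _) (𝟙 ∘ adj G v)                              ≡⟨ sym (∑-vertices _) ⟩
      ∑ vertices (𝟙 ∘ adj G v)                                ≤⟨ ∑-mono vertices (λ {w} _ → neighbour w) ⟩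
      ∑ vertices (λ w → ∑ (classesAt v) (λ κ → 𝟙 (others κ v w)))  ≡⟨ ∑-swap vertices (classesAt v) _ ⟩
      ∑ (classesAt v) (λ κ → ∑ vertices (𝟙 ∘ others κ v))
        ≤⟨ ∑-mono (classesAt v) (λ {κ} κ∈ → ℕP.∸-monoˡ-≤ 1 (others<size {κ} (proj₂ (∈-filter⁻ (λ κ → mem κ v ≟B true) {xs = 𝒞} κ∈)))) ⟩
      ∑ (classesAt v) (λ κ → size κ ∸ 1) ∎
      where
      open ≤-Reasoning
      neighbour : ∀ w → 𝟙 (adj G v w) ≤ ∑ (classesAt v) (λ κ → 𝟙 (others κ v w))
      neighbour w with adj G v w in e
      ... | false = z≤n
      ... | true with edge-class e v∉Z
      ...   | κ , κ∈ , κ∋v , κ∋w = subst (λ b → 𝟙 b ≤ ∑ (classesAt v) (λ κ → 𝟙 (others κ v w))) (others-true κ∋w w≢v)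
              (term≤∑ (λ κ → 𝟙 (others κ v w)) (∈-filter⁺ _ κ∈ κ∋v))
        where
        w≢v : w ≢ v
        w≢v refl = contradiction (trans (sym e) (irrefl G w)) λ ()

    looped⁺ : ∀ {v} → HasLoop G v → looped v ≡ true
    looped⁺ {v} = dec-true (any? λ l → loopAt G l ≟F v)

    -- Balancedness as a cut condition: `S′` bounds the looped vertices in the component of v. A
    -- larger T satisfies the bound by itself.
    ∣T∣≥6 : ∀ T v (S′ : Subset (n G)) → v Sub.∉ T →
      (∀ w → Connected G T v w → HasLoop G w → w Sub.∈ S′) → 6 ≤ ∣ T ∣ + ∣ S′ ∣
    ∣T∣≥6 T v S′ v∉T h with ∣ T ∣ ≤? 6
    ... | no ∣T∣≰6 = ≤-trans (ℕP.<⇒≤ (ℕP.≰⇒> ∣T∣≰6)) (ℕP.m≤m+n _ _)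
    ... | yes ∣T∣≤6 with bal T ∣T∣≤6 v v∉T
    ...   | S , 6∸∣T∣≤∣S∣ , hS = ≤-trans (ℕP.m≤n+m∸n 6 ∣ T ∣) (ℕP.+-monoʳ-≤ ∣ T ∣
      (≤-trans 6∸∣T∣≤∣S∣ (p⊆q⇒∣p∣≤∣q∣ λ {w} w∈S → h w (proj₁ (proj₂ (hS w w∈S))) (proj₂ (proj₂ (hS w w∈S))))))

    -- Deleting the neighbourhood of v leaves v as a component on its own, whose only possible
    -- looped vertex is v.
    degree+loop≥6 : ∀ v → 6 ≤ ∣ Vec.tabulate (adj G v) ∣ + 𝟙 (looped v)
    degree+loop≥6 v = cases
      where
      N : Subset (n G)
      N = Vec.tabulate (adj G v)
      v∉N : v Sub.∉ N
      v∉N v∈ = contradiction (trans (sym (∈tabulate⁻ (adj G v) v∈)) (irrefl G v)) λ ()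
      trapped : ∀ {w} → Connected G N v w → v ≡ w
      trapped ε = refl
      trapped ((_ , w∉N , vw) ◅ _) = contradiction (∈tabulate⁺ (adj G v) vw) w∉N
      unlooped : ∀ {w} → looped v ≡ false → v ≡ w → ¬ HasLoop G w
      unlooped e refl l = contradiction (trans (sym (looped⁺ l)) e) λ ()
      cases : 6 ≤ ∣ N ∣ + 𝟙 (looped v)
      cases with looped v in e
      ... | true  = subst (λ z → 6 ≤ ∣ N ∣ + z) (∣⁅x⁆∣≡1 v)
        (∣T∣≥6 N v ⁅ v ⁆ v∉N λ w c _ → subst (Sub._∈ ⁅ v ⁆) (trapped c) (x∈⁅x⁆ v))
      ... | false = subst (λ z → 6 ≤ ∣ N ∣ + z) (∣⊥∣≡0 (n G))
        (∣T∣≥6 N v Sub.⊥ v∉N λ w c l → ⊥-elim (unlooped e (trapped c) l))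

    -- The good members of a class separate its bad members, none of which has a loop.
    good≥6 : ∀ {κ v} → κ ∈ 𝒞 → mem κ v ≡ true → bad v ≡ true → 6 ≤ ∑ vertices (λ w → 𝟙 (mem κ w ∧ not (bad w)))
    good≥6 {κ} {v} κ∈ κ∋v v-bad = subst (6 ≤_) eq (∣T∣≥6 T′ v Sub.⊥ v∉T λ w c l → ⊥-elim (no-loop (reach κ∋v v-bad c) l))
      where
      good : Fin (n G) → Bool
      good w = mem κ w ∧ not (bad w)
      T′ : Subset (n G)
      T′ = Vec.tabulate good
      eq : ∣ T′ ∣ + ∣ Sub.⊥ {n G} ∣ ≡ ∑ vertices (𝟙 ∘ good)
      eq = trans (cong (∣ T′ ∣ +_) (∣⊥∣≡0 (n G))) (trans (ℕP.+-identityʳ _) (trans (∣tabulate∣ good) (sym (∑-vertices _))))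
      v∉T : v Sub.∉ T′
      v∉T v∈ = contradiction (trans (sym (proj₂ (∧-true {mem κ v} (∈tabulate⁻ good v∈)))) (cong not v-bad)) λ ()
      no-loop : ∀ {w} → bad w ≡ true → ¬ HasLoop G w
      no-loop {w} w-bad l = contradiction (trans (sym (looped⁺ l)) (not-true (proj₁ (∧-true {not (looped w)} (proj₂ (∧-true {not (isZ w)} w-bad)))))) λ ()
      reach : ∀ {u w} → mem κ u ≡ true → bad u ≡ true → Connected G T′ u w → bad w ≡ true
      reach _ u-bad ε = u-bad
      reach {u} κ∋u u-bad (_◅_ {j = w} (_ , w∉T , uw) c) with edge-class uw (not-true (proj₁ (∧-true {not (isZ u)} u-bad)))
      ... | κ′ , κ′∈ , κ′∋u , κ′∋w = reach κ∋w w-bad c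
        where
        -- A bad vertex lies in at most one class, so the step to `w` cannot leave κ.
        κ′≡κ : κ′ ≡ κ
        κ′≡κ = length≤1⇒≡ (ℕP.≤ᵇ⇒≤ _ 1 (subst T (sym (proj₂ (∧-true {not (looped u)} (proj₂ (∧-true {not (isZ u)} u-bad))))) _))
          (∈-filter⁺ _ κ′∈ κ′∋u) (∈-filter⁺ _ κ∈ κ∋u)
        κ∋w : mem κ w ≡ true
        κ∋w = subst (λ κ → mem κ w ≡ true) κ′≡κ κ′∋w
        w-bad : bad w ≡ true
        w-bad with bad w in e
        ... | true  = refl
        ... | false = contradiction (∈tabulate⁺ good (cong₂ _∧_ κ∋w (cong not e))) w∉T

    share : Class → Fin (n G) → ℕ
    share κ v = if bad v then 4 else charge (size κ ∸ 1)

    -- Without bad members all shares equal the uniform charge. With a bad member, six good ones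
    -- exist and the uneven distribution is affordable.
    class-bound : ∀ {κ} → κ ∈ 𝒞 → ∑ vertices (λ v → 𝟙 (mem κ v) * share κ v) ≤ 2 * triangulated (size κ)
    class-bound {κ} κ∈ with any? (λ v → (mem κ v ∧ bad v) ≟B true)
    ... | no none = begin
      ∑ vertices (λ v → 𝟙 (mem κ v) * share κ v)   ≡⟨ ∑-cong vertices eq ⟩
      ∑ vertices (λ v → c * 𝟙 (mem κ v))           ≡⟨ ∑-* vertices c _ ⟩
      c * ∑ vertices (𝟙 ∘ mem κ)                   ≡⟨ cong (c *_) (sym (length-select (mem κ) vertices)) ⟩
      c * size κ                                   ≤⟨ charge-class (size κ) ⟩
      2 * triangulated (size κ) ∎
      where
      open ≤-Reasoning
      c : ℕ
      c = charge (size κ ∸ 1)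
      eq : ∀ v → 𝟙 (mem κ v) * share κ v ≡ c * 𝟙 (mem κ v)
      eq v with mem κ v in e | bad v in e′
      ... | false | _     = sym (ℕP.*-zeroʳ c)
      ... | true  | false = trans (ℕP.+-identityʳ c) (sym (ℕP.*-identityʳ c))
      ... | true  | true  = contradiction (v , cong₂ _∧_ e e′) none
    ... | yes (v , h) with ∧-true {mem κ v} h
    ...   | κ∋v , v-bad = begin
      ∑ vertices (λ v → 𝟙 (mem κ v) * share κ v)   ≤⟨ ∑-mono vertices (λ {w} _ → le w) ⟩
      ∑ vertices (λ w → 4 * D w + 3 * F w)         ≡⟨ ∑-+ vertices (λ w → 4 * D w) (λ w → 3 * F w) ⟩
      ∑ vertices (λ w → 4 * D w) + ∑ vertices (λ w → 3 * F w)  ≡⟨ cong₂ _+_ (∑-* vertices 4 D) (∑-* vertices 3 F) ⟩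
      4 * ∑ vertices D + 3 * ∑ vertices F          ≤⟨ charge-class-bad (∑ vertices D) (∑ vertices F) (good≥6 κ∈ κ∋v v-bad) ⟩
      2 * triangulated (∑ vertices D + ∑ vertices F)
        ≡⟨ cong (λ z → 2 * triangulated z) (trans (sym (∑-+ vertices D F)) (trans (∑-cong vertices split) (sym (length-select (mem κ) vertices)))) ⟩
      2 * triangulated (size κ) ∎
      where
      open ≤-Reasoning
      D F : Fin (n G) → ℕ
      D w = 𝟙 (mem κ w ∧ bad w)
      F w = 𝟙 (mem κ w ∧ not (bad w))
      split : ∀ w → D w + F w ≡ 𝟙 (mem κ w)
      split w with mem κ w | bad w
      ... | false | _     = refl
      ... | true  | true  = refl
      ... | true  | false = refl
      le : ∀ w → 𝟙 (mem κ w) * share κ w ≤ 4 * D w + 3 * F w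
      le w with mem κ w | bad w
      ... | false | _     = z≤n
      ... | true  | true  = ≤-refl
      ... | true  | false = ≤-trans (ℕP.≤-reflexive (ℕP.+-identityʳ _)) (charge≤3 (size κ ∸ 1))

    -- A bad vertex receives 4 from its class. A looped one has 2 from its loop and at least five
    -- neighbours. A good unlooped one has at least two classes and six neighbours.
    vertex-bound : ∀ v → isZ v ≡ false → 4 ≤ 2 * 𝟙 (looped v) + ∑ 𝒞 (λ κ → 𝟙 (mem κ v) * share κ v)
    vertex-bound v v∉Z = subst (λ z → 4 ≤ 2 * 𝟙 (looped v) + z) (∑-select (λ κ → mem κ v) 𝒞 (λ κ → share κ v)) main
      where
      a : Class → ℕ
      a κ = size κ ∸ 1
      6≤ : 6 ≤ ∑ (classesAt v) a + 𝟙 (looped v)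
      6≤ = ≤-trans (degree+loop≥6 v) (ℕP.+-monoˡ-≤ (𝟙 (looped v)) (degree≤ v v∉Z))
      nonempty : ∀ (xs : List Class) b → 6 ≤ ∑ xs a + 𝟙 b → 4 ≤ ∑ xs (λ _ → 4)
      nonempty [] true (s≤s ())
      nonempty (x ∷ xs) b _ = ℕP.m≤m+n 4 _
      main : 4 ≤ 2 * 𝟙 (looped v) + ∑ (classesAt v) (λ κ → share κ v)
      main with bad v in e
      ... | true = ≤-trans (nonempty (classesAt v) (looped v) 6≤) (ℕP.m≤n+m _ (2 * 𝟙 (looped v)))
      ... | false with looped v in e′
      ...   | true = +-mono-≤ {2} ≤-refl (≤-trans
                (≤-trans (s≤s (s≤s z≤n)) (ℕP.≤-reflexive (sym (charge-≥5 (ℕP.+-cancelʳ-≤ 1 5 _ (subst (λ b → 6 ≤ ∑ (classesAt v) a + 𝟙 b) e′ 6≤))))))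
                (charge-∑ (classesAt v) a))
      ...   | false = charge-list (classesAt v) a (ℕP.≰⇒> two)
                (λ κ∈ → let κ∈𝒞 , κ∋v = ∈-filter⁻ (λ κ → mem κ v ≟B true) {xs = 𝒞} κ∈ in 1≤size∸1 κ∈𝒞 κ∋v)
                (subst (6 ≤_) (ℕP.+-identityʳ _) (subst (λ b → 6 ≤ ∑ (classesAt v) a + 𝟙 b) e′ 6≤))
        where
        two : ¬ length (classesAt v) ≤ 1
        two le = contradiction (trans (sym e) (cong₂ _∧_ (cong not v∉Z) (T⇒true (ℕP.≤⇒≤ᵇ le)))) λ ()

    count : n G + n G ≤ (length zeros + length zeros) + (∑ nonzeros (𝟙 ∘ looped) + ∑ 𝒞 (triangulated ∘ size))
    count = subst (λ z → z + z ≤ (Z + Z) + (L + E)) (sym n≡) (ℕP.*-cancelˡ-≤ 2 (begin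
      2 * (Z + U + (Z + U))                       ≡⟨ lemma Z U ⟩
      2 * (Z + Z) + U * 4                         ≤⟨ ℕP.+-monoʳ-≤ (2 * (Z + Z)) total ⟩
      2 * (Z + Z) + (2 * L + 2 * E)               ≡⟨ lemma′ Z L E ⟩
      2 * ((Z + Z) + (L + E)) ∎))
      where
      open ≤-Reasoning
      Z U L E : ℕ
      Z = length zeros
      U = length nonzeros
      L = ∑ nonzeros (𝟙 ∘ looped)
      E = ∑ 𝒞 (triangulated ∘ size)
      lemma : ∀ z u → 2 * (z + u + (z + u)) ≡ 2 * (z + z) + u * 4
      lemma = solve-∀
      lemma′ : ∀ z l e → 2 * (z + z) + (2 * l + 2 * e) ≡ 2 * ((z + z) + (l + e))
      lemma′ = solve-∀
      n≡ : n G ≡ Z + U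
      n≡ = sym (trans (cong₂ _+_ (length≡∑ zeros) (length≡∑ nonzeros)) (trans (∑-partition isZ (allFin (n G)) _)
        (trans (sym (length≡∑ (allFin (n G)))) (length-tabulate id))))
      U*4 : U * 4 ≡ ∑ nonzeros (λ _ → 4)
      U*4 = trans (cong (_* 4) (length≡∑ nonzeros)) (trans (ℕP.*-comm (∑ nonzeros (λ _ → 1)) 4) (sym (∑-* nonzeros 4 (λ _ → 1))))
      total : U * 4 ≤ 2 * L + 2 * E
      total = begin
        U * 4                     ≡⟨ U*4 ⟩
        ∑ nonzeros (λ _ → 4)
          ≤⟨ ∑-mono nonzeros (λ {v} v∈ → vertex-bound v (not-true (proj₂ (∈-filter⁻ (λ v → not (isZ v) ≟B true) {xs = allFin (n G)} v∈)))) ⟩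
        ∑ nonzeros (λ v → 2 * 𝟙 (looped v) + ∑ 𝒞 (λ κ → 𝟙 (mem κ v) * share κ v))
          ≡⟨ ∑-+ nonzeros (λ v → 2 * 𝟙 (looped v)) (λ v → ∑ 𝒞 (λ κ → 𝟙 (mem κ v) * share κ v)) ⟩
        ∑ nonzeros (λ v → 2 * 𝟙 (looped v)) + ∑ nonzeros (λ v → ∑ 𝒞 (λ κ → 𝟙 (mem κ v) * share κ v))
          ≡⟨ cong₂ _+_ (∑-* nonzeros 2 (𝟙 ∘ looped)) (∑-swap nonzeros 𝒞 _) ⟩
        2 * L + ∑ 𝒞 (λ κ → ∑ nonzeros (λ v → 𝟙 (mem κ v) * share κ v))
          ≤⟨ ℕP.+-monoʳ-≤ (2 * L) (∑-mono 𝒞 λ {κ} κ∈ → ≤-trans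
               (≤-trans (ℕP.m≤n+m _ (∑ zeros (λ v → 𝟙 (mem κ v) * share κ v)))
                 (ℕP.≤-reflexive (sym (∑-++ zeros nonzeros (λ v → 𝟙 (mem κ v) * share κ v)))))
               (class-bound κ∈)) ⟩
        2 * L + ∑ 𝒞 (λ κ → 2 * triangulated (size κ))   ≡⟨ cong (2 * L +_) (∑-* 𝒞 2 (triangulated ∘ size)) ⟩
        2 * L + 2 * E ∎

open Counting

open import Algebra.Bundles using (CommutativeRing)
open import Data.Maybe using (Maybe; just; nothing)
open import Data.Nat using (ℕ; zero; suc; z≤n; s≤s) renaming (_+_ to _+ℕ_; _≤_ to _≤ℕ_; _<_ to _<ℕ_)
open import Data.Rational using (ℚ; 0ℚ; 1ℚ; _+_; _*_; _-_; -_; _≤_; _<_; 1/_; ∣_∣; _⊓_; ≢-nonZero; nonNegative; positive; NonNegative; Positive)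
open import Data.Rational.Properties as ℚP using (_≟_; +-*-commutativeRing)
open import Tactic.RingSolver using (solve-∀)
open import Tactic.RingSolver.Core.AlmostCommutativeRing using (AlmostCommutativeRing; fromCommutativeRing)
open import Algebra.Properties.Semiring.Sum (CommutativeRing.semiring +-*-commutativeRing) using (sum; sum-cong-≗; ∑-distrib-+; ∑-comm; *-distribˡ-sum)

-- Rational arithmetic

ℚ-ring : AlmostCommutativeRing _ _
ℚ-ring = fromCommutativeRing +-*-commutativeRing isZero
  where
  isZero : ∀ x → Maybe (0ℚ ≡ x)
  isZero x with 0ℚ ≟ x
  ... | yes p = just p
  ... | no _  = nothing

inverse : ∀ {a} → a ≢ 0ℚ → Σ ℚ λ b → b * a ≡ 1ℚ
inverse {a} a≢0 = (1/ a) {{≢-nonZero a≢0}} , ℚP.*-inverseˡ a {{≢-nonZero a≢0}}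

*≡0⇒≡0 : ∀ {a b} → a ≢ 0ℚ → a * b ≡ 0ℚ → b ≡ 0ℚ
*≡0⇒≡0 {a} {b} a≢0 ab≡0 with inverse a≢0
... | c , ca≡1 = trans (sym (ℚP.*-identityˡ b)) (trans (cong (_* b) (sym ca≡1))
  (trans (ℚP.*-assoc c a b) (trans (cong (c *_) ab≡0) (ℚP.*-zeroʳ c))))

*-zero₁ : ∀ {a} b → a ≡ 0ℚ → a * b ≡ 0ℚ
*-zero₁ b refl = ℚP.*-zeroˡ b

*-zero₂ : ∀ a {b} → b ≡ 0ℚ → a * b ≡ 0ℚ
*-zero₂ a refl = ℚP.*-zeroʳ a

+-zero₁ : ∀ {a} b → a ≡ 0ℚ → a + b ≡ b
+-zero₁ b refl = ℚP.+-identityˡ b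

+-zero₂ : ∀ a {b} → b ≡ 0ℚ → a + b ≡ a
+-zero₂ a refl = ℚP.+-identityʳ a

-≡0⇒≡ : ∀ {a b} → a - b ≡ 0ℚ → a ≡ b
-≡0⇒≡ {a} {b} e = trans (lemma a b) (trans (cong (_+ b) e) (ℚP.+-identityˡ b))
  where
  lemma : ∀ a b → a ≡ (a - b) + b
  lemma = solve-∀ ℚ-ring

≡⇒-≡0 : ∀ {a b} → a ≡ b → a - b ≡ 0ℚ
≡⇒-≡0 {a} refl = ℚP.+-inverseʳ a

-- Finite sums

sum-zero : ∀ {k} {f : Fin k → ℚ} → (∀ i → f i ≡ 0ℚ) → sum f ≡ 0ℚ
sum-zero {zero}  f≡0 = refl
sum-zero {suc k} f≡0 = cong₂ _+_ (f≡0 zero) (sum-zero (λ i → f≡0 (suc i)))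

sum-single : ∀ {k} {f : Fin k → ℚ} i → (∀ j → j ≢ i → f j ≡ 0ℚ) → sum f ≡ f i
sum-single {suc k} {f} zero h =
  trans (cong (f zero +_) (sum-zero (λ j → h (suc j) λ ()))) (ℚP.+-identityʳ _)
sum-single {suc k} {f} (suc i) h =
  trans (cong₂ _+_ (h zero λ ()) (sum-single i (λ j j≢i → h (suc j) λ { refl → j≢i refl }))) (ℚP.+-identityˡ _)

δ : ∀ {k} → Fin k → Fin k → ℚ
δ zero    zero    = 1ℚ
δ zero    (suc _) = 0ℚ
δ (suc _) zero    = 0ℚ
δ (suc i) (suc j) = δ i j

δ-refl : ∀ {k} (i : Fin k) → δ i i ≡ 1ℚ
δ-refl zero    = refl
δ-refl (suc i) = δ-refl i

δ-≢ : ∀ {k} {i j : Fin k} → i ≢ j → δ i j ≡ 0ℚ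
δ-≢ {i = zero}  {zero}  i≢j = ⊥-elim (i≢j refl)
δ-≢ {i = zero}  {suc j} i≢j = refl
δ-≢ {i = suc i} {zero}  i≢j = refl
δ-≢ {i = suc i} {suc j} i≢j = δ-≢ {i = i} {j} λ { refl → i≢j refl }

sum-δʳ : ∀ {k} (f : Fin k → ℚ) j → sum (λ i → f i * δ i j) ≡ f j
sum-δʳ f j = trans (sum-single j λ i i≢j → *-zero₂ (f i) (δ-≢ i≢j))
  (trans (cong (f j *_) (δ-refl j)) (ℚP.*-identityʳ (f j)))

sum-δˡ : ∀ {k} (f : Fin k → ℚ) i → sum (λ j → f j * δ i j) ≡ f i
sum-δˡ f i = trans (sum-single i λ j j≢i → *-zero₂ (f j) (δ-≢ (λ e → j≢i (sym e))))
  (trans (cong (f i *_) (δ-refl i)) (ℚP.*-identityʳ (f i)))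

sum-*ˡ : ∀ {k} a (f : Fin k → ℚ) → sum (λ i → a * f i) ≡ a * sum f
sum-*ˡ a f = sym (*-distribˡ-sum a f)

sum-add : ∀ {k} (f g : Fin k → ℚ) → sum (λ i → f i + g i) ≡ sum f + sum g
sum-add = ∑-distrib-+

sum-sub : ∀ {k} (f g : Fin k → ℚ) → sum (λ i → f i - g i) ≡ sum f - sum g
sum-sub f g = trans (sum-cong-≗ (λ i → lemma (f i) (g i))) (trans (sum-add f _)
  (trans (cong (sum f +_) (sum-*ˡ (- 1ℚ) g)) (sym (lemma (sum f) (sum g)))))
  where
  lemma : ∀ a b → a - b ≡ a + (- 1ℚ) * b
  lemma = solve-∀ ℚ-ring

-- Families of vectors in ℚᵐ

Vector : ℕ → Set
Vector m = Fin m → ℚ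

infix 8 _∙_
_∙_ : ∀ {m} → Vector m → Vector m → ℚ
r ∙ a = sum λ c → r c * a c

comb : ∀ {k m} → Vector k → (Fin k → Vector m) → Vector m
comb ω r c = sum λ i → ω i * r i c

Indep : ∀ {k m} → (Fin k → Vector m) → Set
Indep r = ∀ ω → (∀ c → comb ω r c ≡ 0ℚ) → ∀ i → ω i ≡ 0ℚ

-- A certificate of independence: pairing a relation with `a j` reads off its j-th coefficient, also
-- approximately after a perturbation.
Dual : ∀ {k m} → (Fin k → Vector m) → Set
Dual {k} {m} r = Σ (Fin k → Vector m) λ a → ∀ i j → r i ∙ a j ≡ δ i j

∙-comm : ∀ {m} (r a : Vector m) → r ∙ a ≡ a ∙ r
∙-comm r a = sum-cong-≗ λ c → ℚP.*-comm (r c) (a c)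

∙-zeroˡ : ∀ {m} {r : Vector m} a → (∀ c → r c ≡ 0ℚ) → r ∙ a ≡ 0ℚ
∙-zeroˡ a r≡0 = sum-zero λ c → *-zero₁ (a c) (r≡0 c)

∙-subʳ : ∀ {m} (r a b : Vector m) → r ∙ (λ c → a c - b c) ≡ r ∙ a - r ∙ b
∙-subʳ r a b = trans (sum-cong-≗ λ c → lemma (r c) (a c) (b c)) (sum-sub (λ c → r c * a c) (λ c → r c * b c))
  where
  lemma : ∀ r a b → r * (a - b) ≡ r * a - r * b
  lemma = solve-∀ ℚ-ring

∙-scaleʳ : ∀ {m} (r a : Vector m) t → r ∙ (λ c → t * a c) ≡ t * r ∙ a
∙-scaleʳ r a t = trans (sum-cong-≗ λ c → lemma (r c) t (a c)) (sum-*ˡ t λ c → r c * a c)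
  where
  lemma : ∀ r t a → r * (t * a) ≡ t * (r * a)
  lemma = solve-∀ ℚ-ring

∙-addˡ : ∀ {m} (r s a : Vector m) ε → (λ c → r c + ε * s c) ∙ a ≡ r ∙ a + ε * s ∙ a
∙-addˡ r s a ε = trans (sum-cong-≗ λ c → lemma (r c) (s c) (a c) ε) (trans (sum-add (λ c → r c * a c) (λ c → ε * (s c * a c))) (cong ((r ∙ a) +_) (sum-*ˡ ε λ c → s c * a c)))
  where
  lemma : ∀ r s a ε → (r + ε * s) * a ≡ r * a + ε * (s * a)
  lemma = solve-∀ ℚ-ring

∙-combˡ : ∀ {k m} (ω : Vector k) (r : Fin k → Vector m) y → comb ω r ∙ y ≡ sum λ i → ω i * r i ∙ y
∙-combˡ ω r y = trans (sum-cong-≗ λ c → trans (ℚP.*-comm (comb ω r c) (y c)) (sym (sum-*ˡ (y c) λ i → ω i * r i c)))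
  (trans (∑-comm λ c i → y c * (ω i * r i c)) (sum-cong-≗ λ i → trans (sum-cong-≗ λ c → lemma (y c) (ω i) (r i c)) (sum-*ˡ (ω i) λ c → r i c * y c)))
  where
  lemma : ∀ y ω r → y * (ω * r) ≡ ω * (r * y)
  lemma = solve-∀ ℚ-ring

∙-combʳ : ∀ {k m} (ω : Vector k) (a : Fin k → Vector m) r → r ∙ comb ω a ≡ sum λ i → ω i * r ∙ a i
∙-combʳ ω a r = trans (∙-comm r _) (trans (∙-combˡ ω a r) (sum-cong-≗ λ i → cong (ω i *_) (∙-comm (a i) r)))

dual⇒indep : ∀ {k m} {r : Fin k → Vector m} → Dual r → Indep r
dual⇒indep {r = r} (a , dual) ω ω≡0 j = trans (sym (sum-δʳ ω j))
  (trans (sum-cong-≗ λ i → cong (ω i *_) (sym (dual i j))) (trans (sym (∙-combˡ ω r (a j))) (∙-zeroˡ (a j) ω≡0)))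

indep-cong : ∀ {k m} {r r' : Fin k → Vector m} → (∀ i c → r i c ≡ r' i c) → Indep r → Indep r'
indep-cong e ind ω ω≡0 = ind ω λ c → trans (sum-cong-≗ λ i → cong (ω i *_) (e i c)) (ω≡0 c)

-- The only candidate coefficients for `r zero` over the tail are `r zero ∙ a j`. If the remainder
-- is nonzero at `c₀`, the `c₀`-th unit vector, cleared of its components along the `a i`, is
-- orthogonal to the tail but not to `r zero`; scaled, it becomes the new dual vector and corrects
-- the old ones.
dualStep : ∀ {k m} (r : Fin (suc k) → Vector m) → Dual (λ i → r (suc i)) →
  Dual r ⊎ Σ (Vector k) λ t → ∀ c → r zero c ≡ comb t (λ i → r (suc i)) c
dualStep {k} {m} r (a , dual) with all? (λ c → (r zero c - comb (λ j → r zero ∙ a j) (λ i → r (suc i)) c) ≟ 0ℚ)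
... | yes all0 = inj₂ ((λ j → r zero ∙ a j) , λ c → -≡0⇒≡ (all0 c))
... | no ¬all0 with ¬∀⟶∃¬ _ _ (λ c → (r zero c - comb (λ j → r zero ∙ a j) (λ i → r (suc i)) c) ≟ 0ℚ) ¬all0
...   | c₀ , r'≢0 with inverse r'≢0
...     | β , βr'≡1 = inj₁ (a' , dual')
  where
  r₊ : Fin k → Vector m
  r₊ i = r (suc i)
  t : Vector k
  t j = r zero ∙ a j
  b : Vector m
  b c = β * (δ c c₀ - comb (λ i → r₊ i c₀) a c)
  dot-b : ∀ ρ → ρ ∙ b ≡ β * (ρ c₀ - sum λ i → r₊ i c₀ * ρ ∙ a i)
  dot-b ρ = trans (∙-scaleʳ ρ _ β) (cong (β *_) (trans (∙-subʳ ρ _ _)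
    (cong₂ _-_ (sum-δʳ ρ c₀) (∙-combʳ (λ i → r₊ i c₀) a ρ))))
  b₀ : r zero ∙ b ≡ 1ℚ
  b₀ = trans (dot-b (r zero)) (trans (cong (λ z → β * (r zero c₀ - z)) (sum-cong-≗ λ i → ℚP.*-comm (r₊ i c₀) (t i))) βr'≡1)
  b₊ : ∀ i → r₊ i ∙ b ≡ 0ℚ
  b₊ i = trans (dot-b (r₊ i)) (trans (cong (β *_) (≡⇒-≡0 (sym (trans (sum-cong-≗ λ j → cong (r₊ j c₀ *_) (dual i j))
    (sum-δˡ (λ j → r₊ j c₀) i))))) (ℚP.*-zeroʳ β))
  a' : Fin (suc k) → Vector m
  a' zero    = b
  a' (suc j) c = a j c - t j * b c
  dot-a' : ∀ ρ j → ρ ∙ a' (suc j) ≡ ρ ∙ a j - t j * ρ ∙ b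
  dot-a' ρ j = trans (∙-subʳ ρ _ _) (cong (λ z → ρ ∙ a j - z) (∙-scaleʳ ρ b (t j)))
  x-x*1 : ∀ x → x - x * 1ℚ ≡ 0ℚ
  x-x*1 = solve-∀ ℚ-ring
  x-y*0 : ∀ x y → x - y * 0ℚ ≡ x
  x-y*0 = solve-∀ ℚ-ring
  dual' : ∀ i j → r i ∙ a' j ≡ δ i j
  dual' zero    zero    = b₀
  dual' (suc i) zero    = b₊ i
  dual' zero    (suc j) = trans (dot-a' (r zero) j) (trans (cong (λ z → t j - t j * z) b₀) (x-x*1 (t j)))
  dual' (suc i) (suc j) = trans (dot-a' (r₊ i) j) (trans (cong (λ z → r₊ i ∙ a j - t j * z) (b₊ i))
    (trans (x-y*0 _ (t j)) (dual i j)))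

relation : ∀ {k} → Vector k → Vector (suc k)
relation t zero    = 1ℚ
relation t (suc j) = - t j

relation-comb : ∀ {k m} (r : Fin (suc k) → Vector m) {t} →
  (∀ c → r zero c ≡ comb t (λ i → r (suc i)) c) → ∀ c → comb (relation t) r c ≡ 0ℚ
relation-comb r {t} e c = trans (cong₂ (λ y z → 1ℚ * y + z) (e c) (trans (sum-cong-≗ λ i → lemma (t i) (r (suc i) c)) (sum-*ˡ (- 1ℚ) λ i → t i * r (suc i) c)))
  (lemma' (comb t (λ i → r (suc i)) c))
  where
  lemma : ∀ t r → (- t) * r ≡ (- 1ℚ) * (t * r)
  lemma = solve-∀ ℚ-ring
  lemma' : ∀ z → 1ℚ * z + (- 1ℚ) * z ≡ 0ℚ
  lemma' = solve-∀ ℚ-ring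

-- Subtracting `μ zero` times `ω` from `μ` leaves a relation that avoids row `zero`, hence a
-- relation of the independent tail.
relation-unique : ∀ {k m} {r : Fin (suc k) → Vector m} {ω} → Indep (λ i → r (suc i)) → ω zero ≡ 1ℚ →
  (∀ c → comb ω r c ≡ 0ℚ) → ∀ μ → (∀ c → comb μ r c ≡ 0ℚ) → ∀ i → μ i ≡ μ zero * ω i
relation-unique {k} {m} {r} {ω} ind ω₀≡1 ωr≡0 μ μr≡0 = λ
  { zero    → trans (sym (ℚP.*-identityʳ (μ zero))) (cong (μ zero *_) (sym ω₀≡1))
  ; (suc i) → -≡0⇒≡ (ind (λ i → ν (suc i)) ν₊ i) }
  where
  ν : Vector (suc k)
  ν i = μ i - μ zero * ω i
  ν₀ : ν zero ≡ 0ℚ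
  ν₀ = trans (cong (λ z → μ zero - μ zero * z) ω₀≡1) (lemma (μ zero))
    where
    lemma : ∀ x → x - x * 1ℚ ≡ 0ℚ
    lemma = solve-∀ ℚ-ring
  ν≡0 : ∀ c → comb ν r c ≡ 0ℚ
  ν≡0 c = trans (sum-cong-≗ λ i → lemma (μ i) (μ zero) (ω i) (r i c)) (trans (sum-sub (λ i → μ i * r i c) (λ i → μ zero * (ω i * r i c)))
    (cong₂ _-_ (μr≡0 c) (trans (sum-*ˡ (μ zero) λ i → ω i * r i c) (*-zero₂ (μ zero) (ωr≡0 c)))))
    where
    lemma : ∀ a b w r → (a - b * w) * r ≡ a * r - b * (w * r)
    lemma = solve-∀ ℚ-ring
  ν₊ : ∀ c → comb (λ i → ν (suc i)) (λ i → r (suc i)) c ≡ 0ℚ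
  ν₊ c = trans (sym (+-zero₁ (comb (λ i → ν (suc i)) (λ i → r (suc i)) c) (*-zero₁ (r zero c) ν₀))) (ν≡0 c)

indep? : ∀ {k m} (r : Fin k → Vector m) →
  Dual r ⊎ Σ (Vector k) λ ω → (∃ λ i → ω i ≢ 0ℚ) × (∀ c → comb ω r c ≡ 0ℚ)
indep? {zero}  r = inj₁ ((λ ()) , λ ())
indep? {suc k} r with indep? (λ i → r (suc i))
... | inj₂ (ω , (i , ω≢0) , e) = inj₂ (ω' , (suc i , ω≢0) , λ c →
        trans (+-zero₁ (comb ω (λ i → r (suc i)) c) (ℚP.*-zeroˡ (r zero c))) (e c))
  where
  ω' : Vector (suc k)
  ω' zero    = 0ℚ
  ω' (suc j) = ω j
... | inj₁ d with dualStep r d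
...   | inj₁ d'      = inj₁ d'
...   | inj₂ (t , e) = inj₂ (relation t , (zero , ℚP.1≢0) , relation-comb r {t} e)

indep⇒dual : ∀ {k m} {r : Fin k → Vector m} → Indep r → Dual r
indep⇒dual {r = r} ind with indep? r
... | inj₁ d = d
... | inj₂ (ω , (i , ω≢0) , e) = contradiction (ind ω e i) ω≢0

indep-dec : ∀ {k m} (r : Fin k → Vector m) → Dec (Indep r)
indep-dec r with indep? r
... | inj₁ d = yes (dual⇒indep d)
... | inj₂ (ω , (i , ω≢0) , e) = no λ ind → ω≢0 (ind ω e i)

-- Gaussian elimination: a column `c₀` in which `r zero` is nonzero is cleared from the other rows,
-- then that row and that column are removed.
indep⇒≤ : ∀ {k m} {r : Fin k → Vector m} → Indep r → k ≤ℕ m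
indep⇒≤ {zero} ind = z≤n
indep⇒≤ {suc k} {m} {r} ind with all? (λ c → r zero c ≟ 0ℚ)
... | yes r₀≡0 = contradiction (ind ω₀ (λ c → cong₂ _+_ (trans (ℚP.*-identityˡ (r zero c)) (r₀≡0 c)) (sum-zero λ i → ℚP.*-zeroˡ (r (suc i) c))) zero) ℚP.1≢0
  where
  ω₀ : Vector (suc k)
  ω₀ zero    = 1ℚ
  ω₀ (suc _) = 0ℚ
... | no ¬r₀≡0 with ¬∀⟶∃¬ _ _ (λ c → r zero c ≟ 0ℚ) ¬r₀≡0
indep⇒≤ {suc k} {suc m} {r} ind | no _ | c₀ , r₀≢0 with inverse r₀≢0
... | β , βr≡1 = s≤s (indep⇒≤ {r = r'} ind')
  where
  τ : Vector k
  τ j = r (suc j) c₀ * β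
  r' : Fin k → Vector m
  r' j c = r (suc j) (punchIn c₀ c) - τ j * r zero (punchIn c₀ c)
  ind' : Indep r'
  ind' ω e i = ind ω' ω'≡0 (suc i)
    where
    ω' : Vector (suc k)
    ω' zero    = - sum (λ j → ω j * τ j)
    ω' (suc j) = ω j
    key : ∀ c → comb ω' r c ≡ sum λ j → ω j * (r (suc j) c - τ j * r zero c)
    key c = sym (trans (sum-cong-≗ λ j → lemma (ω j) (r (suc j) c) (τ j) (r zero c))
      (trans (sum-sub (λ j → ω j * r (suc j) c) (λ j → r zero c * (ω j * τ j)))
      (trans (cong (λ z → sum (λ j → ω j * r (suc j) c) - z) (sum-*ˡ (r zero c) λ j → ω j * τ j))
        (lemma' (sum λ j → ω j * r (suc j) c) (r zero c) (sum λ j → ω j * τ j)))))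
      where
      lemma : ∀ w r t r₀ → w * (r - t * r₀) ≡ w * r - r₀ * (w * t)
      lemma = solve-∀ ℚ-ring
      lemma' : ∀ s r₀ t → s - r₀ * t ≡ (- t) * r₀ + s
      lemma' = solve-∀ ℚ-ring
    ω'≡0 : ∀ c → comb ω' r c ≡ 0ℚ
    ω'≡0 c with c₀ ≟F c
    ... | no c₀≢c = trans (key c) (subst (λ d → sum (λ j → ω j * (r (suc j) d - τ j * r zero d)) ≡ 0ℚ)
            (punchIn-punchOut c₀≢c) (e (punchOut c₀≢c)))
    ... | yes refl = trans (key c₀) (sum-zero λ j → *-zero₂ (ω j) (trans (lemma (r (suc j) c₀) β (r zero c₀))
            (*-zero₂ (r (suc j) c₀) (≡⇒-≡0 (sym βr≡1)))))
      where
      lemma : ∀ r b r₀ → r - r * b * r₀ ≡ r * (1ℚ - b * r₀)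
      lemma = solve-∀ ℚ-ring

-- A dual basis together with a common kernel vector is independent.
commonKernel⇒<  : ∀ {k m} {r : Fin k → Vector m} → Dual r → ∀ x → (∃ λ c → x c ≢ 0ℚ) →
  (∀ i → r i ∙ x ≡ 0ℚ) → suc k ≤ℕ m
commonKernel⇒< {k} {m} {r} (a , dual) x (c₀ , x≢0) rx≡0 = indep⇒≤ {r = xa} ind
  where
  xa : Fin (suc k) → Vector m
  xa zero    = x
  xa (suc j) = a j
  ind : Indep xa
  ind ω e = λ { zero → ω₀ ; (suc j) → ω₊ j }
    where
    ω₊ : ∀ j → ω (suc j) ≡ 0ℚ
    ω₊ j = trans (sym (trans (+-zero₁ (sum λ i → ω (suc i) * r j ∙ a i) (*-zero₂ (ω zero) (rx≡0 j)))
      (trans (sum-cong-≗ λ i → cong (ω (suc i) *_) (dual j i)) (sum-δˡ (λ i → ω (suc i)) j))))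
      (trans (sym (∙-combʳ ω xa (r j))) (trans (∙-comm (r j) (comb ω xa)) (∙-zeroˡ (r j) e)))
    ω₀ : ω zero ≡ 0ℚ
    ω₀ = *≡0⇒≡0 x≢0 (trans (ℚP.*-comm (x c₀) (ω zero)) (trans (sym (+-zero₂ (ω zero * x c₀) (sum-zero λ i → *-zero₁ (a i c₀) (ω₊ i)))) (e c₀)))

-- Perturbations

-- Validity for all small enough positive ε. The explicit threshold lets finitely many such
-- properties be combined by a minimum.
Near : (ℚ → Set) → Set
Near Q = Σ ℚ λ ε₀ → 0ℚ < ε₀ × (∀ ε → 0ℚ < ε → ε ≤ ε₀ → Q ε)

near-map : ∀ {P Q : ℚ → Set} → (∀ ε → 0ℚ < ε → P ε → Q ε) → Near P → Near Q
near-map f (ε₀ , pos , h) = ε₀ , pos , λ ε 0<ε ε≤ → f ε 0<ε (h ε 0<ε ε≤)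

near-const : ∀ {Q : ℚ → Set} → (∀ ε → Q ε) → Near Q
near-const h = 1ℚ , ℚP.positive⁻¹ 1ℚ , λ ε _ _ → h ε

near-× : ∀ {P Q : ℚ → Set} → Near P → Near Q → Near λ ε → P ε × Q ε
near-× (a , 0<a , f) (b , 0<b , g) = a ⊓ b , pos , λ ε 0<ε ε≤ →
  f ε 0<ε (ℚP.≤-trans ε≤ (ℚP.p⊓q≤p a b)) , g ε 0<ε (ℚP.≤-trans ε≤ (ℚP.p⊓q≤q a b))
  where
  pos : 0ℚ < a ⊓ b
  pos with ℚP.⊓-sel a b
  ... | inj₁ e = subst (0ℚ <_) (sym e) 0<a
  ... | inj₂ e = subst (0ℚ <_) (sym e) 0<b

near-∀ : ∀ {k} {Q : Fin k → ℚ → Set} → (∀ i → Near (Q i)) → Near λ ε → ∀ i → Q i ε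
near-∀ {zero}  h = near-const λ ε ()
near-∀ {suc k} h = near-map (λ { ε _ (a , b) zero → a ; ε _ (a , b) (suc i) → b i })
  (near-× (h zero) (near-∀ (λ i → h (suc i))))

sum-mono : ∀ {k} {f g : Fin k → ℚ} → (∀ i → f i ≤ g i) → sum f ≤ sum g
sum-mono {zero}  h = ℚP.≤-refl
sum-mono {suc k} h = ℚP.+-mono-≤ (h zero) (sum-mono (λ i → h (suc i)))

∣sum∣≤ : ∀ {k} (f : Fin k → ℚ) → ∣ sum f ∣ ≤ sum (λ i → ∣ f i ∣)
∣sum∣≤ {zero}  f = ℚP.≤-refl
∣sum∣≤ {suc k} f = ℚP.≤-trans (ℚP.∣p+q∣≤∣p∣+∣q∣ (f zero) (sum λ i → f (suc i))) (ℚP.+-monoʳ-≤ ∣ f zero ∣ (∣sum∣≤ (λ i → f (suc i))))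

sum-nonneg : ∀ {k} {f : Fin k → ℚ} → (∀ i → 0ℚ ≤ f i) → 0ℚ ≤ sum f
sum-nonneg {zero}  h = ℚP.≤-refl
sum-nonneg {suc k} h = ℚP.+-mono-≤ (h zero) (sum-nonneg (λ i → h (suc i)))

term≤sum : ∀ {k} {f : Fin k → ℚ} → (∀ i → 0ℚ ≤ f i) → ∀ i → f i ≤ sum f
term≤sum {suc k} {f} h zero    = subst (_≤ sum f) (ℚP.+-identityʳ (f zero)) (ℚP.+-monoʳ-≤ (f zero) (sum-nonneg (λ i → h (suc i))))
term≤sum {suc k} {f} h (suc i) = subst (_≤ sum f) (ℚP.+-identityˡ (f (suc i))) (ℚP.+-mono-≤ (h zero) (term≤sum (λ i → h (suc i)) i))

-- With W the sum of the absolute values of ω and B that of all entries of M, the equation gives W ≤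
-- εBW, while ε(B + 1) ≤ 1 gives εBW + εW ≤ W; together W ≤ 0. Every perturbation argument below is
-- reduced to this contraction.
near-fixpoint : ∀ {k} (M : Fin k → Vector k) →
  Near λ ε → ∀ ω → (∀ j → ω j ≡ ε * M j ∙ ω) → ∀ j → ω j ≡ 0ℚ
near-fixpoint {k} M = ε₀ , 0<ε₀ , h
  where
  B : ℚ
  B = sum λ j → sum λ i → ∣ M j i ∣
  0≤B : 0ℚ ≤ B
  0≤B = sum-nonneg λ j → sum-nonneg λ i → ℚP.0≤∣p∣ (M j i)
  0<B+1 : 0ℚ < B + 1ℚ
  0<B+1 = ℚP.+-mono-≤-< 0≤B (ℚP.positive⁻¹ 1ℚ)
  instance
    B+1-pos : Positive (B + 1ℚ)
    B+1-pos = positive 0<B+1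
  -- Adding 1 to B keeps the reciprocal defined for M = 0 and makes the contraction strict.
  ε₀ : ℚ
  ε₀ = (1/ (B + 1ℚ)) {{ℚP.pos⇒nonZero (B + 1ℚ)}}
  0<ε₀ : 0ℚ < ε₀
  0<ε₀ = ℚP.positive⁻¹ ε₀ {{ℚP.1/pos⇒pos (B + 1ℚ)}}
  h : ∀ ε → 0ℚ < ε → ε ≤ ε₀ → ∀ ω → (∀ j → ω j ≡ ε * M j ∙ ω) → ∀ j → ω j ≡ 0ℚ
  h ε 0<ε ε≤ε₀ ω e j = ℚP.∣p∣≡0⇒p≡0 (ω j) (ℚP.≤-antisym (ℚP.≤-trans (term≤sum (λ i → ℚP.0≤∣p∣ (ω i)) j) W≤0) (ℚP.0≤∣p∣ (ω j)))
    where
    W : ℚ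
    W = sum λ i → ∣ ω i ∣
    0≤W : 0ℚ ≤ W
    0≤W = sum-nonneg λ i → ℚP.0≤∣p∣ (ω i)
    instance
      W-nonNeg : NonNegative W
      W-nonNeg = nonNegative 0≤W
      ε-pos : Positive ε
      ε-pos = positive 0<ε
      ε-nonNeg : NonNegative ε
      ε-nonNeg = ℚP.pos⇒nonNeg ε
    row : ∀ j → ∣ ω j ∣ ≤ ε * W * sum (λ i → ∣ M j i ∣)
    row j = subst₂ _≤_ (sym (trans (cong ∣_∣ (e j)) (trans (ℚP.∣p*q∣≡∣p∣*∣q∣ ε (M j ∙ ω)) (cong (_* ∣ M j ∙ ω ∣) (ℚP.0≤p⇒∣p∣≡p (ℚP.<⇒≤ 0<ε))))))
      (trans (cong (ε *_) (sum-*ˡ W λ i → ∣ M j i ∣)) (sym (ℚP.*-assoc ε W (sum λ i → ∣ M j i ∣))))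
      (ℚP.*-monoˡ-≤-nonNeg ε (ℚP.≤-trans (∣sum∣≤ λ i → M j i * ω i) (sum-mono λ i →
        subst₂ _≤_ (sym (ℚP.∣p*q∣≡∣p∣*∣q∣ (M j i) (ω i))) (ℚP.*-comm ∣ M j i ∣ W)
          (ℚP.*-monoˡ-≤-nonNeg ∣ M j i ∣ {{ℚP.∣-∣-nonNeg (M j i)}} (term≤sum (λ i → ℚP.0≤∣p∣ (ω i)) i)))))
    W≤εWB : W ≤ ε * W * B
    W≤εWB = subst (W ≤_) (sum-*ˡ (ε * W) λ j → sum λ i → ∣ M j i ∣) (sum-mono row)
    εWB+εW≤W : ε * W * B + ε * W ≤ W
    εWB+εW≤W = subst₂ _≤_ (lemma ε W B) (trans (cong (_* W) (ℚP.*-inverseˡ (B + 1ℚ) {{ℚP.pos⇒nonZero (B + 1ℚ)}})) (ℚP.*-identityˡ W))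
      (ℚP.*-monoʳ-≤-nonNeg W (ℚP.*-monoʳ-≤-nonNeg (B + 1ℚ) {{ℚP.pos⇒nonNeg (B + 1ℚ)}} ε≤ε₀))
      where
      lemma : ∀ e w b → e * (b + 1ℚ) * w ≡ e * w * b + e * w
      lemma = solve-∀ ℚ-ring
    W≤0 : W ≤ 0ℚ
    W≤0 = ℚP.*-cancelˡ-≤-pos ε (subst₂ _≤_ (lemma (ε * W * B) (ε * W)) (trans (lemma₀ (ε * W * B)) (sym (ℚP.*-zeroʳ ε)))
      (ℚP.+-monoʳ-≤ (- (ε * W * B)) (ℚP.≤-trans εWB+εW≤W W≤εWB)))
      where
      lemma : ∀ a b → - a + (a + b) ≡ b
      lemma = solve-∀ ℚ-ring
      lemma₀ : ∀ a → - a + a ≡ 0ℚ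
      lemma₀ = solve-∀ ℚ-ring

-- Pairing a relation of the perturbed rows with the dual vectors of `r` expresses each coefficient
-- as ε times a fixed linear form in all coefficients.
near-indep : ∀ {k m} {r : Fin k → Vector m} (s : Fin k → Vector m) → Indep r →
  Near λ ε → Indep λ i c → r i c + ε * s i c
near-indep {k} {m} {r} s ind with indep⇒dual ind
... | a , dual = near-map (λ ε _ h ω e → h ω (fix ε ω e)) (near-fixpoint M)
  where
  M : Fin k → Vector k
  M j i = - (s i ∙ a j)
  fix : ∀ ε ω → (∀ c → comb ω (λ i c → r i c + ε * s i c) c ≡ 0ℚ) → ∀ j → ω j ≡ ε * M j ∙ ω
  fix ε ω e j = -≡0⇒≡ (trans (sym expand) (trans (sym (∙-combˡ ω (λ i c → r i c + ε * s i c) (a j))) (∙-zeroˡ (a j) e)))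
    where
    lemma₁ : ∀ w d ε s → w * (d + ε * s) ≡ w * d - ε * (- s * w)
    lemma₁ = solve-∀ ℚ-ring
    expand : sum (λ i → ω i * (λ c → r i c + ε * s i c) ∙ a j) ≡ ω j - ε * M j ∙ ω
    expand = trans (sum-cong-≗ λ i → trans (cong (ω i *_) (trans (∙-addˡ (r i) (s i) (a j) ε) (cong (_+ ε * s i ∙ a j) (dual i j))))
      (lemma₁ (ω i) (δ i j) ε (s i ∙ a j)))
      (trans (sum-sub (λ i → ω i * δ i j) (λ i → ε * (M j i * ω i))) (cong₂ _-_ (sum-δʳ ω j) (sum-*ˡ ε λ i → M j i * ω i)))

-- A zero of the quadratic would make the vector (1, ε) a fixed point of εM: the first row of M
-- encodes the equation divided by a, the second turns 1 into ε.
near-≢0 : ∀ {a} b c → a ≢ 0ℚ → Near λ ε → a + ε * (b + ε * c) ≢ 0ℚ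
near-≢0 {a} b c a≢0 with inverse a≢0
... | α , αa≡1 = near-map (λ ε _ h e → ℚP.1≢0 (h (ω ε) (fix ε e) zero)) (near-fixpoint M)
  where
  M : Fin 2 → Vector 2
  M zero       zero    = - (α * b)
  M zero       (suc _) = - (α * c)
  M (suc zero) zero    = 1ℚ
  M (suc zero) (suc _) = 0ℚ
  ω : ℚ → Vector 2
  ω ε zero    = 1ℚ
  ω ε (suc _) = ε
  fix : ∀ ε → a + ε * (b + ε * c) ≡ 0ℚ → ∀ j → ω ε j ≡ ε * M j ∙ ω ε
  fix ε e zero = -≡0⇒≡ (trans (cong (_- ε * M zero ∙ ω ε) (sym αa≡1)) (trans (lemma α a ε b c) (trans (cong (α *_) e) (ℚP.*-zeroʳ α))))
    where
    lemma : ∀ α a ε b c → α * a - ε * (- (α * b) * 1ℚ + (- (α * c) * ε + 0ℚ)) ≡ α * (a + ε * (b + ε * c))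
    lemma = solve-∀ ℚ-ring
  fix ε e (suc zero) = lemma ε
    where
    lemma : ∀ ε → ε ≡ ε * (1ℚ * 1ℚ + (0ℚ * ε + 0ℚ))
    lemma = solve-∀ ℚ-ring

-- If x lies in the kernel of a dependent family, pairing a relation of the
-- perturbed family with x leaves only first-order terms.
near-improve : ∀ {k m} {r : Fin (suc k) → Vector m} (s : Fin (suc k) → Vector m) {ω : Vector (suc k)} →
  Indep (λ i → r (suc i)) → ω zero ≡ 1ℚ → (∀ c → comb ω r c ≡ 0ℚ) →
  ∀ x → (∀ i → r i ∙ x ≡ 0ℚ) → sum (λ i → ω i * s i ∙ x) ≢ 0ℚ →
  Near λ ε → Indep λ i c → r i c + ε * s i c
near-improve {k} {m} {r} s {ω} ind ω₀≡1 ωr≡0 x rx≡0 D≢0 with indep⇒dual ind | inverse D≢0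
... | a , dual | γ , γD≡1 = near-map indep (near-fixpoint M)
  where
  D : ℚ
  D = sum λ i → ω i * s i ∙ x
  S : Fin k → ℚ
  S j = sum λ i → ω i * s i ∙ a j
  M : Fin k → Vector k
  M j i = γ * (s (suc i) ∙ x) * S j - s (suc i) ∙ a j
  indep : ∀ ε → 0ℚ < ε → (∀ η → (∀ j → η j ≡ ε * M j ∙ η) → ∀ j → η j ≡ 0ℚ) → Indep λ i c → r i c + ε * s i c
  indep ε 0<ε h μ e = λ { zero → ν≡0 ; (suc j) → μ₊≡0 j }
    where
    ν : ℚ
    ν = μ zero
    -- The relation is split as μ = νω + η, where η lives on the independent tail. It remains to
    -- bound ν by η and η by ε.
    η : Vector k
    η j = μ (suc j) - ν * ω (suc j)
    pair : ∀ y → sum (λ i → μ i * r i ∙ y) + ε * sum (λ i → μ i * s i ∙ y) ≡ 0ℚ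
    pair y = trans (sym (trans (sum-cong-≗ λ i → trans (cong (μ i *_) (∙-addˡ (r i) (s i) y ε)) (lemma (μ i) (r i ∙ y) ε (s i ∙ y)))
      (trans (sum-add (λ i → μ i * r i ∙ y) (λ i → ε * (μ i * s i ∙ y))) (cong (sum (λ i → μ i * r i ∙ y) +_) (sum-*ˡ ε λ i → μ i * s i ∙ y)))))
      (trans (sym (∙-combˡ μ (λ i c → r i c + ε * s i c) y)) (∙-zeroˡ y e))
      where
      lemma : ∀ m r e s → m * (r + e * s) ≡ m * r + e * (m * s)
      lemma = solve-∀ ℚ-ring
    split : ∀ f → sum (λ i → μ i * f i) ≡ ν * sum (λ i → ω i * f i) + sum (λ j → η j * f (suc j))
    split f = trans (sum-cong-≗ λ i → lemma (μ i) ν (ω i) (f i)) (trans (sum-add (λ i → ν * (ω i * f i)) (λ i → (μ i - ν * ω i) * f i))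
      (cong₂ _+_ (sum-*ˡ ν λ i → ω i * f i) (+-zero₁ (sum λ j → η j * f (suc j)) (trans (cong (λ z → (ν - ν * z) * f zero) ω₀≡1) (lemma₀ ν (f zero))))))
      where
      lemma : ∀ m n w f → m * f ≡ n * (w * f) + (m - n * w) * f
      lemma = solve-∀ ℚ-ring
      lemma₀ : ∀ n f → (n - n * 1ℚ) * f ≡ 0ℚ
      lemma₀ = solve-∀ ℚ-ring
    ωr∙ : ∀ y → sum (λ i → ω i * r i ∙ y) ≡ 0ℚ
    ωr∙ y = trans (sym (∙-combˡ ω r y)) (∙-zeroˡ y ωr≡0)
    E : ℚ
    E = sum λ j → η j * s (suc j) ∙ x
    -- In `pair x` the unperturbed part vanishes, so ε can be cancelled; as D is nonzero, this
    -- determines ν linearly from η.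
    νD+E≡0 : ν * D + E ≡ 0ℚ
    νD+E≡0 = trans (sym (split (λ i → s i ∙ x))) (*≡0⇒≡0 (λ ε≡0 → ℚP.<⇒≢ 0<ε (sym ε≡0))
      (trans (sym (+-zero₁ (ε * sum λ i → μ i * s i ∙ x) (sum-zero λ i → *-zero₂ (μ i) (rx≡0 i)))) (pair x)))
    ν≡-γE : ν ≡ - (γ * E)
    ν≡-γE = -≡0⇒≡ (trans (cong (_- - (γ * E)) (trans (sym (ℚP.*-identityʳ ν)) (cong (ν *_) (sym γD≡1))))
      (trans (lemma ν γ D E) (trans (cong (γ *_) νD+E≡0) (ℚP.*-zeroʳ γ))))
      where
      lemma : ∀ n g d e → n * (g * d) - - (g * e) ≡ g * (n * d + e)
      lemma = solve-∀ ℚ-ring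
    ηeq : ∀ j → η j + ε * (ν * S j + sum (λ i → η i * s (suc i) ∙ a j)) ≡ 0ℚ
    ηeq j = trans (cong₂ (λ y z → y + ε * z) (sym (trans (split (λ i → r i ∙ a j)) (trans
        (+-zero₁ (sum λ i → η i * r (suc i) ∙ a j) (*-zero₂ ν (ωr∙ (a j))))
        (trans (sum-cong-≗ λ i → cong (η i *_) (dual i j)) (sum-δʳ η j)))))
        (sym (split (λ i → s i ∙ a j)))) (pair (a j))
    η≡ : ∀ j → η j ≡ ε * M j ∙ η
    η≡ j = trans (lemma₁ (η j) ε ν (S j) F) (trans (cong₂ (λ y z → y - ε * (z * S j + F)) (ηeq j) ν≡-γE)
      (trans (lemma₂ ε γ E (S j) F) (cong (ε *_) (sym Mη))))
      where
      F : ℚ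
      F = sum λ i → η i * s (suc i) ∙ a j
      lemma₁ : ∀ h e n s f → h ≡ (h + e * (n * s + f)) - e * (n * s + f)
      lemma₁ = solve-∀ ℚ-ring
      lemma₂ : ∀ e g E s f → 0ℚ - e * (- (g * E) * s + f) ≡ e * ((g * s) * E - f)
      lemma₂ = solve-∀ ℚ-ring
      lemma₃ : ∀ g x s a h → (g * x * s - a) * h ≡ (g * s) * (h * x) - h * a
      lemma₃ = solve-∀ ℚ-ring
      Mη : M j ∙ η ≡ (γ * S j) * E - F
      Mη = trans (sum-cong-≗ λ i → lemma₃ γ (s (suc i) ∙ x) (S j) (s (suc i) ∙ a j) (η i))
        (trans (sum-sub (λ i → (γ * S j) * (η i * s (suc i) ∙ x)) (λ i → η i * s (suc i) ∙ a j))
          (cong (_- F) (sum-*ˡ (γ * S j) λ i → η i * s (suc i) ∙ x)))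
    η≡0 : ∀ j → η j ≡ 0ℚ
    η≡0 = h η η≡
    ν≡0 : ν ≡ 0ℚ
    ν≡0 = trans ν≡-γE (trans (cong (λ z → - (γ * z)) (sum-zero λ j → *-zero₁ (s (suc j) ∙ x) (η≡0 j)))
      (cong -_ (ℚP.*-zeroʳ γ)))
    μ₊≡0 : ∀ j → μ (suc j) ≡ 0ℚ
    μ₊≡0 j = trans (-≡0⇒≡ (η≡0 j)) (*-zero₁ (ω (suc j)) ν≡0)

-- Linearity in the form needed later: a row may be given by a formula on motions and still be a
-- vector, namely its values on the unit vectors.
Representable : ∀ {k} → (Vector k → ℚ) → Set
Representable f = ∀ y → (λ c → f (δ c)) ∙ y ≡ f y

rep-coord : ∀ {k} (i : Fin k) → Representable λ y → y i
rep-coord i y = trans (∙-comm (λ c → δ c i) y) (sum-δʳ y i)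

rep-+ : ∀ {k} {f g : Vector k → ℚ} → Representable f → Representable g → Representable λ y → f y + g y
rep-+ {f = f} {g} F G y = trans (sum-cong-≗ λ c → ℚP.*-distribʳ-+ (y c) (f (δ c)) (g (δ c)))
  (trans (sum-add (λ c → f (δ c) * y c) (λ c → g (δ c) * y c)) (cong₂ _+_ (F y) (G y)))

rep-* : ∀ {k} {f : Vector k → ℚ} a → Representable f → Representable λ y → a * f y
rep-* {f = f} a F y = trans (sum-cong-≗ λ c → ℚP.*-assoc a (f (δ c)) (y c))
  (trans (sum-*ˡ a λ c → f (δ c) * y c) (cong (a *_) (F y)))

rep-- : ∀ {k} {f g : Vector k → ℚ} → Representable f → Representable g → Representable λ y → f y - g y
rep-- {f = f} {g} F G y = trans (sum-cong-≗ λ c → lemma (f (δ c)) (g (δ c)) (y c))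
  (trans (sum-sub (λ c → f (δ c) * y c) (λ c → g (δ c) * y c)) (cong₂ _-_ (F y) (G y)))
  where
  lemma : ∀ f g y → (f - g) * y ≡ f * y - g * y
  lemma = solve-∀ ℚ-ring

coord : Bool → Pt → ℚ
coord false = proj₁
coord true  = proj₂

cross : Pt → Pt → ℚ
cross (a , b) (c , d) = a * d - b * c

near-list : ∀ {A : Set} (xs : List A) {Q : A → ℚ → Set} → (∀ x → Near (Q x)) → Near λ ε → ∀ {x} → x ∈ xs → Q x ε
near-list []       h = near-const λ ε ()
near-list (x ∷ xs) h = near-map (λ { ε _ (a , b) (here refl) → a ; ε _ (a , b) (there x∈) → b x∈ }) (near-× (h x) (near-list xs h))

fromℕ : ℕ → ℚ
fromℕ zero    = 0ℚ
fromℕ (suc k) = 1ℚ + fromℕ k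

0≤fromℕ : ∀ k → 0ℚ ≤ fromℕ k
0≤fromℕ zero    = ℚP.≤-refl
0≤fromℕ (suc k) = ℚP.+-mono-≤ (ℚP.nonNegative⁻¹ 1ℚ) (0≤fromℕ k)

0<fromℕ-suc : ∀ k → 0ℚ < fromℕ (suc k)
0<fromℕ-suc k = ℚP.+-mono-<-≤ (ℚP.positive⁻¹ 1ℚ) (0≤fromℕ k)

fromℕ-injective : ∀ a b → fromℕ a ≡ fromℕ b → a ≡ b
fromℕ-injective zero    zero    e = refl
fromℕ-injective zero    (suc b) e = ⊥-elim (ℚP.<⇒≢ (0<fromℕ-suc b) e)
fromℕ-injective (suc a) zero    e = ⊥-elim (ℚP.<⇒≢ (0<fromℕ-suc a) (sym e))
fromℕ-injective (suc a) (suc b) e = cong suc (fromℕ-injective a b (-≡0⇒≡ (trans (lemma 1ℚ (fromℕ a) (fromℕ b)) (≡⇒-≡0 e))))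
  where
  lemma : ∀ c a b → a - b ≡ (c + a) - (c + b)
  lemma = solve-∀ ℚ-ring

-- Duplicate-free lists, fan triangulations and plane vectors

private variable
  A B : Set

does-true : ∀ {P : Set} (d : Dec P) → does d ≡ true → P
does-true (yes h) _ = h

does-false : ∀ {P : Set} (d : Dec P) → does d ≡ false → ¬ P
does-false (no h) _ = h

lookup-injective : ∀ {xs : List A} → Unique xs → ∀ {i j} → lookup xs i ≡ lookup xs j → i ≡ j
lookup-injective (_ ∷ _)  {zero}  {zero}  e = refl
lookup-injective {xs = _ ∷ xs} (a ∷ _) {zero}  {suc j} e = ⊥-elim (All.lookup a (∈-lookup {xs = xs} j) e)
lookup-injective {xs = _ ∷ xs} (a ∷ _) {suc i} {zero}  e = ⊥-elim (All.lookup a (∈-lookup {xs = xs} i) (sym e))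
lookup-injective (_ ∷ u) {suc i} {suc j} e = cong suc (lookup-injective u e)

∈-concatMap⁻′ : ∀ (f : A → List B) xs {y} → y ∈ concatMap f xs → ∃ λ x → x ∈ xs × y ∈ f x
∈-concatMap⁻′ f (x ∷ xs) y∈ with ∈-++⁻ (f x) y∈
... | inj₁ h = x , here refl , h
... | inj₂ h with ∈-concatMap⁻′ f xs h
...   | x′ , x′∈ , y∈′ = x′ , there x′∈ , y∈′

unique-concatMap : ∀ (f : A → List B) {xs} → Unique xs → (∀ {x} → x ∈ xs → Unique (f x)) →
  (∀ {x y z} → x ∈ xs → y ∈ xs → z ∈ f x → z ∈ f y → x ≡ y) → Unique (concatMap f xs)
unique-concatMap f {[]} _ _ _ = []
unique-concatMap f {x ∷ xs} (x∉ ∷ u) uf label = UniqueP.++⁺ (uf (here refl))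
  (unique-concatMap f u (uf ∘ there) (λ a b → label (there a) (there b)))
  λ { (z∈ , z∈′) → let y , y∈ , z∈y = ∈-concatMap⁻′ f xs z∈′ in
      All.lookup x∉ y∈ (label (here refl) (there y∈) z∈ z∈y) }

∈-take : ∀ k {xs : List A} {x} → x ∈ take k xs → x ∈ xs
∈-take (suc k) {_ ∷ _} (here e)   = here e
∈-take (suc k) {_ ∷ _} (there x∈) = there (∈-take k x∈)

allPairs : ∀ {R : A → A → Set} {xs} → (∀ {a b} → a ∈ xs → b ∈ xs → R a b) → AllPairs R xs
allPairs {xs = []}     h = []
allPairs {xs = x ∷ xs} h = All.tabulate (λ y∈ → h (here refl) (there y∈)) ∷ allPairs (λ a b → h (there a) (there b))

fan : A → A → A → List (A × A)
fan a b v = (v , a) ∷ (v , b) ∷ []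

-- A minimally rigid graph on the given vertices.
triangulate : List A → List (A × A)
triangulate (a ∷ b ∷ rest) = (b , a) ∷ concatMap (fan a b) rest
triangulate _              = []

length-triangulate : ∀ (xs : List A) → length (triangulate xs) ≡ triangulated (length xs)
length-triangulate []       = refl
length-triangulate (_ ∷ []) = refl
length-triangulate (a ∷ b ∷ rest) = cong suc (go rest)
  where
  go : ∀ ys → length (concatMap (fan a b) ys) ≡ length ys +ℕ length ys
  go []       = refl
  go (y ∷ ys) = cong suc (trans (cong suc (go ys)) (sym (ℕP.+-suc (length ys) (length ys))))

∈-fan : ∀ {a b w v u : A} → (v , u) ∈ fan a b w → v ≡ w × (u ≡ a ⊎ u ≡ b)
∈-fan (here refl)         = refl , inj₁ refl
∈-fan (there (here refl)) = refl , inj₂ refl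

∈-triangulate : ∀ (xs : List A) {v u} → (v , u) ∈ triangulate xs → ∃ λ a → ∃ λ b → ∃ λ rest →
  xs ≡ a ∷ b ∷ rest × ((v ≡ b × u ≡ a) ⊎ (v ∈ rest × (u ≡ a ⊎ u ≡ b)))
∈-triangulate (a ∷ b ∷ rest) (here refl) = a , b , rest , refl , inj₁ (refl , refl)
∈-triangulate (a ∷ b ∷ rest) (there h) with ∈-concatMap⁻′ (fan a b) rest h
... | w , w∈ , h′ with ∈-fan h′
...   | refl , u≡ = a , b , rest , refl , inj₂ (w∈ , u≡)

unique-triangulate : ∀ {xs : List A} → Unique xs → Unique (triangulate xs)
unique-triangulate {xs = []}     _ = []
unique-triangulate {xs = _ ∷ []} _ = []
unique-triangulate {xs = a ∷ b ∷ rest} ((a≢b ∷ _) ∷ (b∉ ∷ u)) =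
  All.tabulate (λ { {_ , _} h refl → let w , w∈ , h′ = ∈-concatMap⁻′ (fan a b) rest h in
      All.lookup b∉ w∈ (proj₁ (∈-fan h′)) }) ∷
  unique-concatMap (fan a b) u (λ _ → ((λ { refl → a≢b refl }) ∷ []) ∷ [] ∷ [])
    (λ { {z = _ , _} _ _ h h′ → trans (sym (proj₁ (∈-fan h))) (proj₁ (∈-fan h′)) })

-- Made total by the value 0 at 0, so that a candidate class can be written down for every pair of
-- vertices.
recip : ℚ → ℚ
recip a with a ≟ 0ℚ
... | yes _  = 0ℚ
... | no a≢0 = proj₁ (inverse a≢0)

recip-* : ∀ {a} → a ≢ 0ℚ → recip a * a ≡ 1ℚ
recip-* {a} a≢0 with a ≟ 0ℚ
... | yes a≡0 = contradiction a≡0 a≢0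
... | no ne   = proj₂ (inverse ne)

·-origin : ∀ a → a · origin ≡ 0ℚ
·-origin (a , b) = cong₂ _+_ (ℚP.*-zeroʳ a) (ℚP.*-zeroʳ b)

origin-· : ∀ a → origin · a ≡ 0ℚ
origin-· (a , b) = cong₂ _+_ (ℚP.*-zeroˡ a) (ℚP.*-zeroˡ b)

⊖-origin : ∀ d → d ⊖ origin ≡ d
⊖-origin (a , b) = cong₂ _,_ (lemma a) (lemma b)
  where
  lemma : ∀ a → a - 0ℚ ≡ a
  lemma = solve-∀ ℚ-ring

unit : Bool → Pt
unit false = 1ℚ , 0ℚ
unit true  = 0ℚ , 1ℚ

single : ∀ {k} → Fin k → Pt → Fin k → Pt
single v d w with w ≟F v
... | yes _ = d
... | no _  = origin

single-≡ : ∀ {k} (v : Fin k) d → single v d v ≡ d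
single-≡ v d with v ≟F v
... | yes _  = refl
... | no v≢v = contradiction refl v≢v

single-≢ : ∀ {k} {v w : Fin k} d → w ≢ v → single v d w ≡ origin
single-≢ {v = v} {w} d w≢v with w ≟F v
... | yes w≡v = contradiction w≡v w≢v
... | no _    = refl

unit-·₁ : ∀ a → unit false · a ≡ proj₁ a
unit-·₁ (a , b) = lemma a b
  where
  lemma : ∀ a b → 1ℚ * a + 0ℚ * b ≡ a
  lemma = solve-∀ ℚ-ring

unit-·₂ : ∀ a → unit true · a ≡ proj₂ a
unit-·₂ (a , b) = lemma a b
  where
  lemma : ∀ a b → 0ℚ * a + 1ℚ * b ≡ b
  lemma = solve-∀ ℚ-ring

perp : Pt → Pt
perp (a , b) = b , - a

perp-· : ∀ a → a · perp a ≡ 0ℚ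
perp-· (a , b) = lemma a b
  where
  lemma : ∀ a b → a * b + b * (- a) ≡ 0ℚ
  lemma = solve-∀ ℚ-ring

·-perp : ∀ a b → a · perp b ≡ cross a b
·-perp (a , b) (c , d) = lemma a b c d
  where
  lemma : ∀ a b c d → a * d + b * (- c) ≡ a * d - b * c
  lemma = solve-∀ ℚ-ring

-- Frameworks, their rows, and small moves

module Frameworks (G : LoopedGraph) where

  Motion : Set
  Motion = Fin (n G) → Pt

  record Framework : Set where
    constructor framework
    field
      p : Fin (n G) → Pt
      q : Fin (m G) → Pt
  open Framework public

  data Row : Set where
    edge : Fin (n G) → Fin (n G) → Row
    loop : Fin (m G) → Row
    pin  : Fin (n G) → Bool → Row

  -- Pins do not move with the framework: the scalar is 1 for a framework
  -- and 0 for a direction of perturbation.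
  eval : ℚ → Framework → Row → Motion → ℚ
  eval t s (edge u v) y = (p s u ⊖ p s v) · (y u ⊖ y v)
  eval t s (loop l)   y = q s l · y (loopAt G l)
  eval t s (pin v b)  y = t * coord b (y v)

  eval-cong : ∀ t s r {y z} → (∀ v → y v ≡ z v) → eval t s r y ≡ eval t s r z
  eval-cong t s (edge u v) e = cong₂ (λ a b → (p s u ⊖ p s v) · (a ⊖ b)) (e u) (e v)
  eval-cong t s (loop l)   e = cong (q s l ·_) (e (loopAt G l))
  eval-cong t s (pin v b)  e = cong (λ a → t * coord b a) (e v)

  pt : Vector (n G +ℕ n G) → Motion
  pt y v = y (v ↑ˡ n G) , y (n G ↑ʳ v)

  flat : Motion → Vector (n G +ℕ n G)
  flat x c = [ (λ v → proj₁ (x v)) , (λ v → proj₂ (x v)) ]′ (splitAt (n G) c)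

  pt-flat : ∀ x v → pt (flat x) v ≡ x v
  pt-flat x v = cong₂ _,_ (cong [ _ , _ ]′ (splitAt-↑ˡ (n G) v (n G))) (cong [ _ , _ ]′ (splitAt-↑ʳ (n G) (n G) v))

  vec : ℚ → Framework → Row → Vector (n G +ℕ n G)
  vec t s r c = eval t s r (pt (δ c))

  vec-∙ : ∀ t s r y → vec t s r ∙ y ≡ eval t s r (pt y)
  vec-∙ t s (edge u v) = rep-+ (rep-* (proj₁ (p s u ⊖ p s v)) (rep-- (rep-coord (u ↑ˡ n G)) (rep-coord (v ↑ˡ n G))))
                               (rep-* (proj₂ (p s u ⊖ p s v)) (rep-- (rep-coord (n G ↑ʳ u)) (rep-coord (n G ↑ʳ v))))
  vec-∙ t s (loop l) = rep-+ (rep-* (proj₁ (q s l)) (rep-coord (loopAt G l ↑ˡ n G))) (rep-* (proj₂ (q s l)) (rep-coord (n G ↑ʳ loopAt G l)))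
  vec-∙ t s (pin v false) = rep-* t (rep-coord (v ↑ˡ n G))
  vec-∙ t s (pin v true)  = rep-* t (rep-coord (n G ↑ʳ v))

  vec-∙-flat : ∀ t s r z → vec t s r ∙ flat z ≡ eval t s r z
  vec-∙-flat t s r z = trans (vec-∙ t s r (flat z)) (eval-cong t s r (pt-flat z))

  movePt : Pt → ℚ → Pt → Pt
  movePt (a , b) ε (c , d) = a + ε * c , b + ε * d

  move : Framework → ℚ → Framework → Framework
  move s ε d = framework (λ v → movePt (p s v) ε (p d v)) (λ l → movePt (q s l) ε (q d l))

  ·-move : ∀ a ε c x → movePt a ε c · x ≡ a · x + ε * (c · x)
  ·-move (a , b) ε (c , d) (x , y) = lemma a b ε c d x y
    where
    lemma : ∀ a b ε c d x y → (a + ε * c) * x + (b + ε * d) * y ≡ (a * x + b * y) + ε * (c * x + d * y)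
    lemma = solve-∀ ℚ-ring

  ⊖-move : ∀ a b ε c d → movePt a ε c ⊖ movePt b ε d ≡ movePt (a ⊖ b) ε (c ⊖ d)
  ⊖-move (a , a′) (b , b′) ε (c , c′) (d , d′) = cong₂ _,_ (lemma a b ε c d) (lemma a′ b′ ε c′ d′)
    where
    lemma : ∀ a b ε c d → (a + ε * c) - (b + ε * d) ≡ (a - b) + ε * (c - d)
    lemma = solve-∀ ℚ-ring

  cross-move : ∀ a ε b c d → cross (movePt a ε b) (movePt c ε d) ≡ cross a c + ε * ((cross a d + cross b c) + ε * cross b d)
  cross-move (a , a′) ε (b , b′) (c , c′) (d , d′) = lemma a a′ ε b b′ c c′ d d′
    where
    lemma : ∀ a a′ ε b b′ c c′ d d′ → (a + ε * b) * (c′ + ε * d′) - (a′ + ε * b′) * (c + ε * d) ≡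
      (a * c′ - a′ * c) + ε * (((a * d′ - a′ * d) + (b * c′ - b′ * c)) + ε * (b * d′ - b′ * d))
    lemma = solve-∀ ℚ-ring

  -- Rows are linear in p and q, so there is no second-order term; a pin has no first-order term
  -- either.
  eval-move : ∀ s ε d r y → eval 1ℚ (move s ε d) r y ≡ eval 1ℚ s r y + ε * eval 0ℚ d r y
  eval-move s ε d (edge u v) y = trans (cong (_· (y u ⊖ y v)) (⊖-move (p s u) (p s v) ε (p d u) (p d v)))
    (·-move (p s u ⊖ p s v) ε (p d u ⊖ p d v) (y u ⊖ y v))
  eval-move s ε d (loop l) y = ·-move (q s l) ε (q d l) (y (loopAt G l))
  eval-move s ε d (pin v b) y = lemma (coord b (y v)) ε
    where
    lemma : ∀ a ε → 1ℚ * a ≡ 1ℚ * a + ε * (0ℚ * a)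
    lemma = solve-∀ ℚ-ring

  rows : ℚ → Framework → (h : List Row) → Fin (length h) → Vector (n G +ℕ n G)
  rows t s h i = vec t s (lookup h i)

  IndepAt : Framework → List Row → Set
  IndepAt s h = Indep (rows 1ℚ s h)

  near-move : ∀ s d h → Near (λ ε → Indep λ i c → rows 1ℚ s h i c + ε * rows 0ℚ d h i c) → Near λ ε → IndepAt (move s ε d) h
  near-move s d h = near-map λ ε _ → indep-cong λ i c → sym (eval-move s ε d (lookup h i) (pt (δ c)))

  -- Distinct first coordinates are more than distinct points: they allow an angular velocity to be
  -- solved for by one division.
  record GeneralPosition (s : Framework) : Set where
    field
      separated    : ∀ {u v} → u ≢ v → proj₁ (p s u) - proj₁ (p s v) ≢ 0ℚ
      noncollinear : ∀ {u v w} → u ≢ v → u ≢ w → v ≢ w → cross (p s u ⊖ p s v) (p s u ⊖ p s w) ≢ 0ℚ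
  open GeneralPosition public

  near-generalPosition : ∀ {s} d → GeneralPosition s → Near λ ε → GeneralPosition (move s ε d)
  near-generalPosition {s} d gp = near-map
    (λ ε _ (sep , col) → record { separated = λ {u} {v} → sep u v ; noncollinear = λ {u} {v} {w} → col u v w })
    (near-× (near-∀ λ u → near-∀ λ v → near-separated u v)
            (near-∀ λ u → near-∀ λ v → near-∀ λ w → near-noncollinear u v w))
    where
    near-separated : ∀ u v → Near λ ε → u ≢ v → proj₁ (p (move s ε d) u) - proj₁ (p (move s ε d) v) ≢ 0ℚ
    near-separated u v with u ≟F v
    ... | yes u≡v = near-const λ ε u≢v → contradiction u≡v u≢v
    ... | no u≢v = near-map (λ ε _ h _ e → h (trans (sym (lemma (proj₁ (p s u)) (proj₁ (p s v)) ε (proj₁ (p d u)) (proj₁ (p d v)))) e)) (near-≢0 (proj₁ (p d u) - proj₁ (p d v)) 0ℚ (separated gp u≢v))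
      where
      lemma : ∀ a b ε c d → (a + ε * c) - (b + ε * d) ≡ (a - b) + ε * ((c - d) + ε * 0ℚ)
      lemma = solve-∀ ℚ-ring
    near-noncollinear : ∀ u v w → Near λ ε → u ≢ v → u ≢ w → v ≢ w →
      cross (p (move s ε d) u ⊖ p (move s ε d) v) (p (move s ε d) u ⊖ p (move s ε d) w) ≢ 0ℚ
    near-noncollinear u v w with u ≟F v | u ≟F w | v ≟F w
    ... | yes e | _     | _     = near-const λ ε ≢ → contradiction e ≢
    ... | no _  | yes e | _     = near-const λ ε _ ≢ → contradiction e ≢
    ... | no _  | no _  | yes e = near-const λ ε _ _ ≢ → contradiction e ≢
    ... | no u≢v | no u≢w | no v≢w = near-map (λ ε _ h _ _ _ e → h (trans (sym (expand ε)) e))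
          (near-≢0 (cross uv uw′ + cross uv′ uw) (cross uv′ uw′) (noncollinear gp u≢v u≢w v≢w))
      where
      uv uv′ uw uw′ : Pt
      uv = p s u ⊖ p s v
      uv′ = p d u ⊖ p d v
      uw = p s u ⊖ p s w
      uw′ = p d u ⊖ p d w
      expand : ∀ ε → cross (p (move s ε d) u ⊖ p (move s ε d) v) (p (move s ε d) u ⊖ p (move s ε d) w) ≡
        cross uv uw + ε * ((cross uv uw′ + cross uv′ uw) + ε * cross uv′ uw′)
      expand ε = trans (cong₂ cross (⊖-move (p s u) (p s v) ε (p d u) (p d v)) (⊖-move (p s u) (p s w) ε (p d u) (p d w)))
        (cross-move uv ε uv′ uw uw′)

  -- On the points (i, i²) the cross product of two differences is a Vandermonde product. The loop
  -- directions may start at zero, because general position restricts only p.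
  momentCurve : Framework
  momentCurve = framework (λ v → fromℕ (toℕ v) , fromℕ (toℕ v) * fromℕ (toℕ v)) (λ _ → origin)

  momentCurve-generalPosition : GeneralPosition momentCurve
  momentCurve-generalPosition = record
    { separated    = sep
    ; noncollinear = λ {u} {v} {w} u≢v u≢w v≢w e → sep (λ w≡v → v≢w (sym w≡v))
        (*≡0⇒≡0 (sep u≢w) (*≡0⇒≡0 (sep u≢v) (trans (sym (lemma (fromℕ (toℕ u)) (fromℕ (toℕ v)) (fromℕ (toℕ w)))) e)))
    }
    where
    sep : ∀ {u v : Fin (n G)} → u ≢ v → fromℕ (toℕ u) - fromℕ (toℕ v) ≢ 0ℚ
    sep u≢v e = u≢v (toℕ-injective (fromℕ-injective _ _ (-≡0⇒≡ e)))
    lemma : ∀ a b c → (a - b) * (a * a - c * c) - (a * a - b * b) * (a - c) ≡ (a - b) * ((a - c) * (c - b))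
    lemma = solve-∀ ℚ-ring

  -- All ordered pairs occur, adjacent or not, since triangulations of classes use pairs outside E.
  allRows : List Row
  allRows = cartesianProductWith edge (allFin (n G)) (allFin (n G)) ++
    (map loop (allFin (m G)) ++ cartesianProductWith pin (allFin (n G)) (false ∷ true ∷ []))

  ∈-allRows : ∀ r → r ∈ allRows
  ∈-allRows (edge u v) = ∈-++⁺ˡ (∈-cartesianProductWith⁺ edge (∈-allFin u) (∈-allFin v))
  ∈-allRows (loop l)   = ∈-++⁺ʳ (cartesianProductWith edge (allFin (n G)) (allFin (n G))) (∈-++⁺ˡ (∈-map⁺ loop (∈-allFin l)))
  ∈-allRows (pin v b)  = ∈-++⁺ʳ (cartesianProductWith edge (allFin (n G)) (allFin (n G)))
    (∈-++⁺ʳ (map loop (allFin (m G))) (∈-cartesianProductWith⁺ pin (∈-allFin v) (∈-bool b)))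
    where
    ∈-bool : ∀ b → b ∈ (false ∷ true ∷ [])
    ∈-bool false = here refl
    ∈-bool true  = there (here refl)

  rowLists : ℕ → List (List Row)
  rowLists zero    = [] ∷ []
  rowLists (suc k) = [] ∷ cartesianProductWith _∷_ allRows (rowLists k)

  ∈-rowLists : ∀ {k} h → length h ≤ℕ k → h ∈ rowLists k
  ∈-rowLists {zero}  []      _         = here refl
  ∈-rowLists {suc k} []      _         = here refl
  ∈-rowLists {suc k} (r ∷ h) (s≤s le) = there (∈-cartesianProductWith⁺ _∷_ (∈-allRows r) (∈-rowLists h le))

  -- Selects the rows of R(G,p,q).
  present : Row → ℚ
  present (edge u v) with adj G u v
  ... | true  = 1ℚ
  ... | false = 0ℚ
  present (loop l)  = 1ℚ
  present (pin _ _) = 0ℚ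

  record KernelVector (s : Framework) : Set where
    field
      x         : Vector (n G +ℕ n G)
      nonzero   : ∃ λ c → x c ≢ 0ℚ
      edge-zero : ∀ {u v} → adj G u v ≡ true → eval 1ℚ s (edge u v) (pt x) ≡ 0ℚ
      loop-zero : ∀ l → eval 1ℚ s (loop l) (pt x) ≡ 0ℚ

  -- Full rank is independence of the columns, and a relation between columns is a kernel vector.
  -- Rows outside R(G,p,q) are masked by zeros instead of being removed.
  columns : Framework → Fin (n G +ℕ n G) → Vector (length allRows)
  columns s c ρ = present (lookup allRows ρ) * vec 1ℚ s (lookup allRows ρ) c

  column-sum : ∀ s x r → sum (λ c → x c * (present r * vec 1ℚ s r c)) ≡ present r * eval 1ℚ s r (pt x)
  column-sum s x r = trans (sum-cong-≗ λ c → lemma (x c) (present r) (vec 1ℚ s r c))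
    (trans (sum-*ˡ (present r) λ c → vec 1ℚ s r c * x c) (cong (present r *_) (vec-∙ 1ℚ s r x)))
    where
    lemma : ∀ x g v → x * (g * v) ≡ g * (v * x)
    lemma = solve-∀ ℚ-ring

  inKernel⇒zero : ∀ {s x} → InKernel G (p s) (q s) x → ∀ r → present r * eval 1ℚ s r x ≡ 0ℚ
  inKernel⇒zero {s} {x} (edges , loops) (edge u v) with adj G u v in e
  ... | false = ℚP.*-zeroˡ (eval 1ℚ s (edge u v) x)
  ... | true  = *-zero₂ 1ℚ (trans (lemma (proj₁ (p s u)) (proj₂ (p s u)) (proj₁ (p s v)) (proj₂ (p s v))
    (proj₁ (x u)) (proj₂ (x u)) (proj₁ (x v)) (proj₂ (x v))) (edges u v e))
    where
    lemma : ∀ a b c d x y z w →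
      (a - c) * (x - z) + (b - d) * (y - w) ≡ ((a - c) * x + (b - d) * y) + ((c - a) * z + (d - b) * w)
    lemma = solve-∀ ℚ-ring
  inKernel⇒zero (edges , loops) (loop l) = *-zero₂ 1ℚ (loops l)
  inKernel⇒zero {s} {x} (edges , loops) (pin v b) = ℚP.*-zeroˡ (eval 1ℚ s (pin v b) x)

  present-edge : ∀ {u v} → adj G u v ≡ true → present (edge u v) ≡ 1ℚ
  present-edge {u} {v} uv with adj G u v
  present-edge {u} {v} refl | true = refl

  fullRank? : ∀ s → FullRank G (p s) (q s) ⊎ KernelVector s
  fullRank? s = Sum.map full kernel (indep? (columns s))
    where
    full : Dual (columns s) → FullRank G (p s) (q s)
    full dual x ker v = trans (sym (pt-flat x v)) (cong₂ _,_ (flat≡0 (v ↑ˡ n G)) (flat≡0 (n G ↑ʳ v)))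
      where
      flat≡0 : ∀ c → flat x c ≡ 0ℚ
      flat≡0 = dual⇒indep {r = columns s} dual (flat x) λ ρ → trans (column-sum s (flat x) (lookup allRows ρ))
        (trans (cong (present (lookup allRows ρ) *_) (eval-cong 1ℚ s (lookup allRows ρ) (pt-flat x)))
          (inKernel⇒zero {s} {x} ker (lookup allRows ρ)))
    kernel : (Σ (Vector (n G +ℕ n G)) λ x → (∃ λ c → x c ≢ 0ℚ) × (∀ ρ → comb x (columns s) ρ ≡ 0ℚ)) → KernelVector s
    kernel (x , nz , e) = record
      { x = x ; nonzero = nz
      ; edge-zero = λ {u} {v} uv → trans (sym (ℚP.*-identityˡ (eval 1ℚ s (edge u v) (pt x))))
          (trans (cong (_* eval 1ℚ s (edge u v) (pt x)) (sym (present-edge uv))) (row (edge u v)))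
      ; loop-zero = λ l → trans (sym (ℚP.*-identityˡ (eval 1ℚ s (loop l) (pt x)))) (row (loop l)) }
      where
      row : ∀ r → present r * eval 1ℚ s r (pt x) ≡ 0ℚ
      row r = trans (sym (column-sum s x r)) (subst (λ r → sum (λ c → x c * (present r * vec 1ℚ s r c)) ≡ 0ℚ)
        (sym (lookup-index (∈-allRows r))) (e (index (∈-allRows r))))

  -- Strict improvement and its termination

  record Improvement (s : Framework) : Set where
    field
      s′         : Framework
      gp′        : GeneralPosition s′
      h          : List Row
      h-short    : length h ≤ℕ n G +ℕ n G
      dependent  : ¬ IndepAt s h
      independent : IndepAt s′ h
      preserved  : ∀ {h} → h ∈ rowLists (n G +ℕ n G) → IndepAt s h → IndepAt s′ h

  -- One ε has to serve `h`, general position and every independent list of bounded length. These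
  -- are finitely many `Near` conditions, so a common ε exists.
  improve : ∀ {s} → GeneralPosition s → ∀ d h → length h ≤ℕ n G +ℕ n G → ¬ IndepAt s h →
    Near (λ ε → IndepAt (move s ε d) h) → Improvement s
  improve {s} gp d h short dep near = at (near-× near (near-× (near-generalPosition d gp) (near-list (rowLists (n G +ℕ n G)) keep)))
    where
    keep : ∀ h → Near λ ε → IndepAt s h → IndepAt (move s ε d) h
    keep h with indep-dec (rows 1ℚ s h)
    ... | yes ind = near-map (λ ε _ ind′ _ → ind′) (near-move s d h (near-indep (rows 0ℚ d h) ind))
    ... | no dep  = near-const λ ε ind → contradiction ind dep
    at : Near (λ ε → IndepAt (move s ε d) h × GeneralPosition (move s ε d) ×
      (∀ {h} → h ∈ rowLists (n G +ℕ n G) → IndepAt s h → IndepAt (move s ε d) h)) → Improvement s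
    at (ε , 0<ε , good) with good ε 0<ε ℚP.≤-refl
    ... | independent , gp′ , preserved = record
      { s′ = move s ε d ; gp′ = gp′ ; h = h ; h-short = short ; dependent = dep
      ; independent = independent ; preserved = preserved }

  climb : (∀ s → GeneralPosition s → FullRank G (p s) (q s) ⊎ Improvement s) → ∀ s → GeneralPosition s → Rigid G
  climb step s gp = go (suc (deficit s)) s gp ℕP.≤-refl
    where
    dep : Framework → List Row → ℕ
    dep s h = 𝟙 (not (does (indep-dec (rows 1ℚ s h))))
    deficit : Framework → ℕ
    deficit s = ∑ (rowLists (n G +ℕ n G)) (dep s)
    dep-1 : ∀ {s h} → ¬ IndepAt s h → dep s h ≡ 1
    dep-1 {s} {h} d = cong (𝟙 ∘ not) (dec-false (indep-dec (rows 1ℚ s h)) d)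
    dep-0 : ∀ {s h} → IndepAt s h → dep s h ≡ 0
    dep-0 {s} {h} i = cong (𝟙 ∘ not) (dec-true (indep-dec (rows 1ℚ s h)) i)
    decreases : ∀ {s} (imp : Improvement s) → deficit (Improvement.s′ imp) <ℕ deficit s
    decreases {s} imp = ∑-mono-< (∈-rowLists h h-short)
      (subst₂ _<ℕ_ (sym (dep-0 {s′} {h} independent)) (sym (dep-1 {s} {h} dependent)) (s≤s z≤n)) weak
      where
      open Improvement imp
      weak : ∀ {h} → h ∈ rowLists (n G +ℕ n G) → dep s′ h ≤ℕ dep s h
      weak {h} h∈ with indep-dec (rows 1ℚ s h)
      ... | yes ind = ℕP.≤-reflexive (dep-0 {s′} {h} (preserved h∈ ind))
      ... | no _    = 𝟙≤1 (not (does (indep-dec (rows 1ℚ s′ h))))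
        where
        𝟙≤1 : ∀ b → 𝟙 b ≤ℕ 1
        𝟙≤1 true  = ℕP.≤-refl
        𝟙≤1 false = z≤n
    go : ∀ k s → GeneralPosition s → deficit s <ℕ k → Rigid G
    go (suc k) s gp lt with step s gp
    ... | inj₁ full = p s , q s , full
    ... | inj₂ imp  = go k (Improvement.s′ imp) (Improvement.gp′ imp) (ℕP.<-≤-trans (decreases imp) (ℕP.≤-pred lt))

  -- The list is processed from its end. The first row that depends on the rows behind it yields a
  -- relation with leading coefficient 1 over an independent tail, so the relation is unique up to
  -- scaling.
  scan : ∀ s (Q : List Row → Set) → (∀ {r h} → Q (r ∷ h) → Q h) → ∀ h → Q h →
    Dual (rows 1ℚ s h) ⊎ Σ Row λ e → Σ (List Row) λ S → Q (e ∷ S) × Dual (rows 1ℚ s S) ×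
      Σ (Vector (length S)) λ t → ∀ c → vec 1ℚ s e c ≡ comb t (rows 1ℚ s S) c
  scan s Q Q-tail []      q = inj₁ ((λ ()) , λ ())
  scan s Q Q-tail (r ∷ h) q with scan s Q Q-tail h (Q-tail q)
  ... | inj₂ found = inj₂ found
  ... | inj₁ d with dualStep (rows 1ℚ s (r ∷ h)) d
  ...   | inj₁ d′      = inj₁ d′
  ...   | inj₂ (t , e) = inj₂ (r , h , q , d , t , e)

  -- Classes on which the kernel vector is a rigid motion

  module Motions (bal : Balanced 6 G) (s : Framework) (gp : GeneralPosition s) (ker : KernelVector s) where
    open KernelVector ker

    X : Motion
    X = pt x

    X₁ X₂ p₁ p₂ : Fin (n G) → ℚ
    X₁ v = proj₁ (X v)
    X₂ v = proj₂ (X v)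
    p₁ v = proj₁ (p s v)
    p₂ v = proj₂ (p s v)

    -- (a , b , c) stands for the infinitesimal rigid motion with angular velocity a whose
    -- rotation by a right angle is z ↦ a z + (b , c).
    Class : Set
    Class = ℚ × ℚ × ℚ

    _≟C_ : (κ κ′ : Class) → Dec (κ ≡ κ′)
    _≟C_ = ≡-dec _≟_ (≡-dec _≟_ _≟_)

    record In (κ : Class) (v : Fin (n G)) : Set where
      constructor inClass
      field
        eq₂ : - X₂ v ≡ proj₁ κ * p₁ v + proj₁ (proj₂ κ)
        eq₁ : X₁ v ≡ proj₁ κ * p₂ v + proj₂ (proj₂ κ)

    In? : ∀ κ v → Dec (In κ v)
    In? (a , b , c) v = map′ (uncurry inClass) (λ (inClass e₂ e₁) → e₂ , e₁)
      ((- X₂ v ≟ (a * p₁ v + b)) ×-dec (X₁ v ≟ (a * p₂ v + c)))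

    zeroClass : Class
    zeroClass = 0ℚ , 0ℚ , 0ℚ

    diff₁ : ∀ {κ u v} → In κ u → In κ v → X₁ u - X₁ v ≡ proj₁ κ * (p₂ u - p₂ v)
    diff₁ {a , b , c} {u} {v} (inClass _ eu) (inClass _ ev) = trans (cong₂ _-_ eu ev) (lemma a c (p₂ u) (p₂ v))
      where
      lemma : ∀ a c x y → (a * x + c) - (a * y + c) ≡ a * (x - y)
      lemma = solve-∀ ℚ-ring

    diff₂ : ∀ {κ u v} → In κ u → In κ v → X₂ u - X₂ v ≡ - (proj₁ κ * (p₁ u - p₁ v))
    diff₂ {a , b , c} {u} {v} (inClass eu _) (inClass ev _) = trans (lemma (X₂ u) (X₂ v)) (trans (cong -_ (cong₂ _-_ eu ev)) (cong -_ (lemma′ a b (p₁ u) (p₁ v))))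
      where
      lemma : ∀ x y → x - y ≡ - (- x - - y)
      lemma = solve-∀ ℚ-ring
      lemma′ : ∀ a c x y → (a * x + c) - (a * y + c) ≡ a * (x - y)
      lemma′ = solve-∀ ℚ-ring

    in-zero : ∀ {v} → In zeroClass v → X v ≡ origin
    in-zero {v} (inClass e₂ e₁) = cong₂ _,_ (trans e₁ (lemma (p₂ v))) (trans (lemma′ (X₂ v)) (cong -_ (trans e₂ (lemma (p₁ v)))))
      where
      lemma : ∀ a → 0ℚ * a + 0ℚ ≡ 0ℚ
      lemma = solve-∀ ℚ-ring
      lemma′ : ∀ a → a ≡ - (- a)
      lemma′ = solve-∀ ℚ-ring

    zero-in : ∀ {v} → X v ≡ origin → In zeroClass v
    zero-in {v} e = inClass (trans (cong (λ z → - proj₂ z) e) (lemma (p₁ v))) (trans (cong proj₁ e) (lemma (p₂ v)))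
      where
      lemma : ∀ a → 0ℚ ≡ 0ℚ * a + 0ℚ
      lemma = solve-∀ ℚ-ring

    -- Once the angular velocity is fixed, the value at one vertex fixes the translation. Hence
    -- different classes of equal angular velocity have no common vertex.
    same-slope : ∀ {κ κ′ v} → proj₁ κ ≡ proj₁ κ′ → In κ v → In κ′ v → κ ≡ κ′
    same-slope {a , b , c} {_ , b′ , c′} {v} refl (inClass e₂ e₁) (inClass e₂′ e₁′) =
      cong₂ (λ b c → a , b , c) (cancel (a * p₁ v) b b′ (trans (sym e₂) e₂′)) (cancel (a * p₂ v) c c′ (trans (sym e₁) e₁′))
      where
      cancel : ∀ z b b′ → z + b ≡ z + b′ → b ≡ b′
      cancel z b b′ e = -≡0⇒≡ (trans (lemma z b b′) (≡⇒-≡0 e))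
        where
        lemma : ∀ z b b′ → b - b′ ≡ (z + b) - (z + b′)
        lemma = solve-∀ ℚ-ring

    -- The difference of the second components of `X` at u and v is minus the angular velocity times
    -- a nonzero difference of first coordinates.
    in-unique : ∀ {κ κ′ u v} → u ≢ v → In κ u → In κ v → In κ′ u → In κ′ v → κ ≡ κ′
    in-unique {κ} {κ′} {u} {v} u≢v iu iv iu′ iv′ = same-slope slopes iu iu′
      where
      lemma : ∀ a b d → d * (a - b) ≡ - (b * d) - - (a * d)
      lemma = solve-∀ ℚ-ring
      slopes : proj₁ κ ≡ proj₁ κ′
      slopes = -≡0⇒≡ (*≡0⇒≡0 (separated gp u≢v) (trans (lemma (proj₁ κ) (proj₁ κ′) (p₁ u - p₁ v))
        (≡⇒-≡0 (trans (sym (diff₂ iu′ iv′)) (diff₂ iu iv)))))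

    -- The angular velocity is solved from the second components of `X`, and the translation is
    -- fitted at u.
    classOf : Fin (n G) → Fin (n G) → Class
    classOf u v = a , - X₂ u - a * p₁ u , X₁ u - a * p₂ u
      where a = (X₂ v - X₂ u) * recip (p₁ u - p₁ v)

    in-classOf₁ : ∀ u v → In (classOf u v) u
    in-classOf₁ u v = inClass (lemma (- X₂ u) (proj₁ (classOf u v) * p₁ u)) (lemma (X₁ u) (proj₁ (classOf u v) * p₂ u))
      where
      lemma : ∀ z w → z ≡ w + (z - w)
      lemma = solve-∀ ℚ-ring

    -- The equation for `X₂` holds by the choice of angular velocity; the one for `X₁` is where the
    -- vanishing edge row enters.
    in-classOf₂ : ∀ {u v} → u ≢ v → eval 1ℚ s (edge u v) X ≡ 0ℚ → In (classOf u v) v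
    in-classOf₂ {u} {v} u≢v e = inClass
      (-≡0⇒≡ (trans (lemma₁ (X₂ u) (X₂ v) r (p₁ u) (p₁ v)) (*-zero₂ (X₂ u - X₂ v) (≡⇒-≡0 (sym rP≡1)))))
      (-≡0⇒≡ (trans (lemma₂ (X₁ u) (X₁ v) (X₂ u) (X₂ v) r (p₁ u) (p₁ v) (p₂ u) (p₂ v))
        (cong₂ _-_ (*-zero₂ (X₁ u - X₁ v) (≡⇒-≡0 rP≡1)) (*-zero₂ r e))))
      where
      r = recip (p₁ u - p₁ v)
      rP≡1 : r * (p₁ u - p₁ v) ≡ 1ℚ
      rP≡1 = recip-* (separated gp u≢v)
      lemma₁ : ∀ x y r a b → - y - ((y - x) * r * b + (- x - (y - x) * r * a)) ≡ (x - y) * (1ℚ - r * (a - b))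
      lemma₁ = solve-∀ ℚ-ring
      lemma₂ : ∀ x y z w r a b c d → y - ((w - z) * r * d + (x - (w - z) * r * c)) ≡
        (x - y) * (r * (a - b) - 1ℚ) - r * ((a - b) * (x - y) + (c - d) * (z - w))
      lemma₂ = solve-∀ ℚ-ring

    -- The pairs moved rigidly by x, adjacent or not. Generating classes from them ensures that each
    -- has at least two members.
    Linked : Fin (n G) × Fin (n G) → Set
    Linked (u , v) = u ≢ v × In (classOf u v) v

    linked? : ∀ uv → Dec (Linked uv)
    linked? (u , v) = ¬? (u ≟F v) ×-dec In? (classOf u v) v

    linkedPairs : List (Fin (n G) × Fin (n G))
    linkedPairs = filter linked? (cartesianProduct (allFin (n G)) (allFin (n G)))

    nonzeroClass? : ∀ κ → Dec (κ ≢ zeroClass)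
    nonzeroClass? κ = ¬? (κ ≟C zeroClass)

    𝒞 : List Class
    𝒞 = filter nonzeroClass? (deduplicate _≟C_ (map (uncurry classOf) linkedPairs))

    𝒞-unique : Unique 𝒞
    𝒞-unique = UniqueP.filter⁺ nonzeroClass? (DecUniqueP.deduplicate-! _≟C_ (map (uncurry classOf) linkedPairs))

    𝒞-nonzero : ∀ {κ} → κ ∈ 𝒞 → κ ≢ zeroClass
    𝒞-nonzero κ∈ = proj₂ (∈-filter⁻ nonzeroClass? {xs = deduplicate _≟C_ (map (uncurry classOf) linkedPairs)} κ∈)

    mem : Class → Fin (n G) → Bool
    mem κ v = does (In? κ v)

    mem⁺ : ∀ {κ v} → In κ v → mem κ v ≡ true
    mem⁺ {κ} {v} = dec-true (In? κ v)

    mem⁻ : ∀ {κ v} → mem κ v ≡ true → In κ v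
    mem⁻ {κ} {v} = does-true (In? κ v)

    isZ : Fin (n G) → Bool
    isZ = mem zeroClass

    edge-class : ∀ {u v} → adj G u v ≡ true → isZ u ≡ false → ∃ λ κ → κ ∈ 𝒞 × mem κ u ≡ true × mem κ v ≡ true
    edge-class {u} {v} uv u∉Z = classOf u v , κ∈ , mem⁺ {classOf u v} {u} (in-classOf₁ u v) , mem⁺ {classOf u v} {v} v∈κ
      where
      u≢v : u ≢ v
      u≢v refl = contradiction (trans (sym uv) (irrefl G u)) λ ()
      v∈κ : In (classOf u v) v
      v∈κ = in-classOf₂ u≢v (edge-zero uv)
      κ≢0 : classOf u v ≢ zeroClass
      κ≢0 e = does-false (In? zeroClass u) u∉Z (subst (λ κ → In κ u) e (in-classOf₁ u v))
      κ∈ : classOf u v ∈ 𝒞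
      κ∈ = ∈-filter⁺ nonzeroClass? (∈-deduplicate⁺ _≟C_ (∈-map⁺ (uncurry classOf)
        (∈-filter⁺ linked? (∈-cartesianProduct⁺ (∈-allFin u) (∈-allFin v)) (u≢v , v∈κ)))) κ≢0

    other-member : ∀ {κ v} → κ ∈ 𝒞 → mem κ v ≡ true → ∃ λ w → w ≢ v × mem κ w ≡ true
    other-member {κ} {v} κ∈ _ with ∈-map⁻ (uncurry classOf) (∈-deduplicate⁻ _≟C_ (map (uncurry classOf) linkedPairs)
      (proj₁ (∈-filter⁻ nonzeroClass? {xs = deduplicate _≟C_ (map (uncurry classOf) linkedPairs)} κ∈)))
    ... | (u , w) , uw∈ , refl with ∈-filter⁻ linked? {xs = cartesianProduct (allFin (n G)) (allFin (n G))} uw∈ | u ≟F v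
    ...   | _ , u≢w , w∈κ | yes refl = w , (λ w≡u → u≢w (sym w≡u)) , mem⁺ {classOf u w} {w} w∈κ
    ...   | _ , u≢w , w∈κ | no u≢v   = u , u≢v , mem⁺ {classOf u w} {u} (in-classOf₁ u w)

    open Discharging G bal isZ 𝒞 mem edge-class other-member

    zeros-Z : ∀ {v} → v ∈ zeros → isZ v ≡ true
    zeros-Z v∈ = proj₂ (∈-filter⁻ (λ v → isZ v ≟B true) {xs = allFin (n G)} v∈)

    nonzeros-Z : ∀ {v} → v ∈ nonzeros → isZ v ≡ false
    nonzeros-Z v∈ = not-true (proj₂ (∈-filter⁻ (λ v → not (isZ v) ≟B true) {xs = allFin (n G)} v∈))

    zeros-unique : Unique zeros
    zeros-unique = UniqueP.filter⁺ (λ v → isZ v ≟B true) (UniqueP.allFin⁺ (n G))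

    nonzeros-unique : Unique nonzeros
    nonzeros-unique = UniqueP.filter⁺ (λ v → not (isZ v) ≟B true) (UniqueP.allFin⁺ (n G))

    ZeroFirst : Fin (n G) → Fin (n G) → Set
    ZeroFirst u v = isZ v ≡ true → isZ u ≡ true

    vertices-zeroFirst : AllPairs ZeroFirst vertices
    vertices-zeroFirst = AllPairsP.++⁺ (allPairs λ u∈ _ _ → zeros-Z u∈)
      (allPairs λ _ v∈ z → contradiction (trans (sym z) (nonzeros-Z v∈)) λ ())
      (All.tabulate λ u∈ → All.tabulate λ _ _ → zeros-Z u∈)

    members-unique : ∀ κ → Unique (members κ)
    members-unique κ = UniqueP.filter⁺ (λ v → mem κ v ≟B true) (UniqueP.++⁺ zeros-unique nonzeros-unique
      λ (v∈ , v∈′) → contradiction (trans (sym (zeros-Z v∈)) (nonzeros-Z v∈′)) λ ())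

    members-in : ∀ {κ v} → v ∈ members κ → In κ v
    members-in {κ} {v} v∈ = mem⁻ {κ} {v} (proj₂ (∈-filter⁻ (λ v → mem κ v ≟B true) {xs = vertices} v∈))

    -- Zero vertices come first, so if v were in Z the head `a` would be too, and two common
    -- vertices would make κ the zero class. Hence no pin acts at a later vertex.
    later-nonzero : ∀ {κ a xs v} → κ ∈ 𝒞 → members κ ≡ a ∷ xs → v ∈ xs → ¬ In zeroClass v
    later-nonzero {κ} {a} {xs} {v} κ∈ eq v∈ v-zero with subst Unique eq (members-unique κ)
      | subst (AllPairs ZeroFirst) eq (AllPairsP.filter⁺ (λ v → mem κ v ≟B true) vertices-zeroFirst)
    ... | a∉ ∷ _ | zf ∷ _ = 𝒞-nonzero κ∈ (in-unique (All.lookup a∉ v∈) (inn (here refl)) (inn (there v∈))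
            (mem⁻ {zeroClass} {a} (All.lookup zf v∈ (mem⁺ {zeroClass} {v} v-zero))) v-zero)
      where
      inn : ∀ {w} → w ∈ a ∷ xs → In κ w
      inn w∈ = members-in (subst (_ ∈_) (sym eq) w∈)

    -- The row list `H`

    pinsAt : Fin (n G) → List Row
    pinsAt v = pin v false ∷ pin v true ∷ []

    -- A single loop per vertex is enough, because balancedness counts looped vertices and not
    -- loops.
    loopsAt : Fin (n G) → List Row
    loopsAt v with any? (λ l → loopAt G l ≟F v)
    ... | yes (l , _) = loop l ∷ []
    ... | no _        = []

    edgesOf : Class → List Row
    edgesOf κ = map (uncurry edge) (triangulate (members κ))

    H : List Row
    H = concatMap pinsAt zeros ++ (concatMap loopsAt nonzeros ++ concatMap edgesOf 𝒞)

    data InH : Row → Set where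
      pinᴴ  : ∀ {v b} → In zeroClass v → InH (pin v b)
      loopᴴ : ∀ {l} → X (loopAt G l) ≢ origin → InH (loop l)
      edgeᴴ : ∀ {κ v u} → κ ∈ 𝒞 → (v , u) ∈ triangulate (members κ) → InH (edge v u)

    ∈-loopsAt : ∀ {v r} → r ∈ loopsAt v → ∃ λ l → r ≡ loop l × loopAt G l ≡ v
    ∈-loopsAt {v} r∈ with any? (λ l → loopAt G l ≟F v)
    ∈-loopsAt (here e) | yes (l , lv) = l , e , lv
    ∈-loopsAt ()       | no _

    pins∈ : ∀ {r} → r ∈ concatMap pinsAt zeros → ∃ λ v → ∃ λ b → r ≡ pin v b × In zeroClass v
    pins∈ r∈ with ∈-concatMap⁻′ pinsAt zeros r∈
    ... | v , v∈ , here e         = v , false , e , mem⁻ {zeroClass} {v} (zeros-Z v∈)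
    ... | v , v∈ , there (here e) = v , true , e , mem⁻ {zeroClass} {v} (zeros-Z v∈)

    loops∈ : ∀ {r} → r ∈ concatMap loopsAt nonzeros → ∃ λ l → r ≡ loop l × X (loopAt G l) ≢ origin
    loops∈ r∈ with ∈-concatMap⁻′ loopsAt nonzeros r∈
    ... | v , v∈ , r∈v with ∈-loopsAt r∈v
    ...   | l , e , refl = l , e , λ e → does-false (In? zeroClass v) (nonzeros-Z v∈) (zero-in e)

    edges∈ : ∀ {r} → r ∈ concatMap edgesOf 𝒞 → ∃ λ κ → ∃ λ v → ∃ λ u → r ≡ edge v u × κ ∈ 𝒞 × (v , u) ∈ triangulate (members κ)
    edges∈ r∈ with ∈-concatMap⁻′ edgesOf 𝒞 r∈
    ... | κ , κ∈ , r∈κ with ∈-map⁻ (uncurry edge) r∈κ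
    ...   | (v , u) , vu∈ , e = κ , v , u , e , κ∈ , vu∈

    H-inH : ∀ {r} → r ∈ H → InH r
    H-inH r∈ with ∈-++⁻ (concatMap pinsAt zeros) r∈
    ... | inj₁ h with pins∈ h
    ...   | v , b , refl , z = pinᴴ z
    H-inH r∈ | inj₂ h with ∈-++⁻ (concatMap loopsAt nonzeros) h
    ... | inj₁ h′ with loops∈ h′
    ...   | l , refl , nz = loopᴴ nz
    H-inH r∈ | inj₂ h | inj₂ h′ with edges∈ h′
    ... | κ , v , u , refl , κ∈ , vu∈ = edgeᴴ κ∈ vu∈

    triangulated-in : ∀ {κ v u} → (v , u) ∈ triangulate (members κ) → In κ v × In κ u × v ≢ u
    triangulated-in {κ} vu∈ with ∈-triangulate (members κ) vu∈
    ... | a , b , rest , eq , h with subst Unique eq (members-unique κ)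
    triangulated-in {κ} vu∈ | a , b , rest , eq , inj₁ (refl , refl) | (a≢b ∷ _) ∷ _ =
      members-in (subst (b ∈_) (sym eq) (there (here refl))) , members-in (subst (a ∈_) (sym eq) (here refl)) , λ e → a≢b (sym e)
    triangulated-in {κ} {v} vu∈ | a , b , rest , eq , inj₂ (v∈ , inj₁ refl) | (_ ∷ a∉) ∷ _ =
      members-in (subst (v ∈_) (sym eq) (there (there v∈))) , members-in (subst (a ∈_) (sym eq) (here refl)) , λ e → All.lookup a∉ v∈ (sym e)
    triangulated-in {κ} {v} vu∈ | a , b , rest , eq , inj₂ (v∈ , inj₂ refl) | _ ∷ (b∉ ∷ _) =
      members-in (subst (v ∈_) (sym eq) (there (there v∈))) , members-in (subst (b ∈_) (sym eq) (there (here refl))) , λ e → All.lookup b∉ v∈ (sym e)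

    edge-injective : ∀ {e e′ : Fin (n G) × Fin (n G)} → uncurry edge e ≡ uncurry edge e′ → e ≡ e′
    edge-injective refl = refl

    H-unique : Unique H
    H-unique = UniqueP.++⁺ pins-unique (UniqueP.++⁺ loops-unique edges-unique
        λ (h , h′) → loop≢edge (loops∈ h) (edges∈ h′))
      λ (h , h′) → [ (λ h′ → pin≢loop (pins∈ h) (loops∈ h′)) , (λ h′ → pin≢edge (pins∈ h) (edges∈ h′)) ]′ (∈-++⁻ (concatMap loopsAt nonzeros) h′)
      where
      loop≢edge : ∀ {r} {P : Fin (m G) → Set} {Q : Class → Fin (n G) → Fin (n G) → Set} →
        (∃ λ l → r ≡ loop l × P l) → (∃ λ κ → ∃ λ v → ∃ λ u → r ≡ edge v u × Q κ v u) → ⊥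
      loop≢edge (_ , refl , _) (_ , _ , _ , () , _)
      pin≢loop : ∀ {r} {P : Fin (n G) → Bool → Set} {Q : Fin (m G) → Set} →
        (∃ λ v → ∃ λ b → r ≡ pin v b × P v b) → (∃ λ l → r ≡ loop l × Q l) → ⊥
      pin≢loop (_ , _ , refl , _) (_ , () , _)
      pin≢edge : ∀ {r} {P : Fin (n G) → Bool → Set} {Q : Class → Fin (n G) → Fin (n G) → Set} →
        (∃ λ v → ∃ λ b → r ≡ pin v b × P v b) → (∃ λ κ → ∃ λ v → ∃ λ u → r ≡ edge v u × Q κ v u) → ⊥
      pin≢edge (_ , _ , refl , _) (_ , _ , _ , () , _)
      pins-unique : Unique (concatMap pinsAt zeros)
      pins-unique = unique-concatMap pinsAt zeros-unique (λ _ → ((λ ()) ∷ []) ∷ [] ∷ []) λ _ _ → label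
        where
        label : ∀ {v w r} → r ∈ pinsAt v → r ∈ pinsAt w → v ≡ w
        label (here refl)         (here refl)         = refl
        label (there (here refl)) (there (here refl)) = refl
        label (here refl)         (there (here ()))
      loops-unique : Unique (concatMap loopsAt nonzeros)
      loops-unique = unique-concatMap loopsAt nonzeros-unique (λ {v} _ → atMostOne v) λ _ _ h h′ → label (∈-loopsAt h) (∈-loopsAt h′)
        where
        atMostOne : ∀ v → Unique (loopsAt v)
        atMostOne v with any? (λ l → loopAt G l ≟F v)
        ... | yes _ = [] ∷ []
        ... | no _  = []
        label : ∀ {v w r} → (∃ λ l → r ≡ loop l × loopAt G l ≡ v) → (∃ λ l → r ≡ loop l × loopAt G l ≡ w) → v ≡ w
        label (_ , refl , refl) (_ , refl , refl) = refl
      edges-unique : Unique (concatMap edgesOf 𝒞)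
      edges-unique = unique-concatMap edgesOf 𝒞-unique (λ {κ} _ → UniqueP.map⁺ edge-injective (unique-triangulate (members-unique κ)))
        λ _ _ h h′ → label (∈-map⁻ (uncurry edge) h) (∈-map⁻ (uncurry edge) h′)
        where
        label : ∀ {κ κ′ r} → (∃ λ e → e ∈ triangulate (members κ) × r ≡ uncurry edge e) →
          (∃ λ e → e ∈ triangulate (members κ′) × r ≡ uncurry edge e) → κ ≡ κ′
        label (_ , e∈ , refl) (_ , e∈′ , refl) with triangulated-in e∈ | triangulated-in e∈′
        ... | iv , iu , v≢u | iv′ , iu′ , _ = in-unique v≢u iv iu iv′ iu′

    H-long : n G +ℕ n G ≤ℕ length H
    H-long = subst (n G +ℕ n G ≤ℕ_) (sym eq) count
      where
      loops-length : ∀ v → length (loopsAt v) ≡ 𝟙 (looped v)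
      loops-length v with any? (λ l → loopAt G l ≟F v)
      ... | yes _ = refl
      ... | no _  = refl
      pins-length : ∀ vs → length (concatMap pinsAt vs) ≡ length vs +ℕ length vs
      pins-length []       = refl
      pins-length (v ∷ vs) = cong suc (trans (cong suc (pins-length vs)) (sym (ℕP.+-suc (length vs) (length vs))))
      eq : length H ≡ (length zeros +ℕ length zeros) +ℕ (∑ nonzeros (𝟙 ∘ looped) +ℕ ∑ 𝒞 (triangulated ∘ size))
      eq = trans (length-++ (concatMap pinsAt zeros)) (cong₂ _+ℕ_ (pins-length zeros)
        (trans (length-++ (concatMap loopsAt nonzeros)) (cong₂ _+ℕ_
          (trans (length-concatMap loopsAt nonzeros) (∑-cong nonzeros loops-length))
          (trans (length-concatMap edgesOf 𝒞) (∑-cong 𝒞 λ κ → trans (length-map (uncurry edge) (triangulate (members κ))) (length-triangulate (members κ)))))))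

    -- Inside a class `X v ⊖ X u` is a multiple of the rotated difference of positions, hence
    -- orthogonal to that difference.
    edge-killed : ∀ {κ v u} → In κ v → In κ u → eval 1ℚ s (edge v u) X ≡ 0ℚ
    edge-killed {κ} {v} {u} iv iu = trans (cong₂ (λ a b → (p₁ v - p₁ u) * a + (p₂ v - p₂ u) * b) (diff₁ iv iu) (diff₂ iv iu))
      (lemma (proj₁ κ) (p₁ v - p₁ u) (p₂ v - p₂ u))
      where
      lemma : ∀ a x y → x * (a * y) + y * (- (a * x)) ≡ 0ℚ
      lemma = solve-∀ ℚ-ring

    killed : ∀ {r} → InH r → eval 1ℚ s r X ≡ 0ℚ
    killed (pinᴴ {v} {false} z) = *-zero₂ 1ℚ (cong proj₁ (in-zero z))
    killed (pinᴴ {v} {true} z)  = *-zero₂ 1ℚ (cong proj₂ (in-zero z))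
    killed (loopᴴ {l} _) = loop-zero l
    killed (edgeᴴ {κ} κ∈ vu∈) = let iv , iu , _ = triangulated-in {κ} vu∈ in edge-killed iv iu

    record InsideH (h : List Row) : Set where
      field
        unique : Unique h
        inH    : ∀ {r} → r ∈ h → InH r
        short  : length h ≤ℕ n G +ℕ n G

    insideH-tail : ∀ {r h} → InsideH (r ∷ h) → InsideH h
    insideH-tail I = record
      { unique = AllPairs.tail (InsideH.unique I) ; inH = InsideH.inH I ∘ there ; short = ℕP.<⇒≤ (InsideH.short I) }

    -- The relation on a dependent sublist of `H`

    module Relation (e : Row) (S : List Row) (inside : InsideH (e ∷ S)) (dual : Dual (rows 1ℚ s S))
      (t : Vector (length S)) (e≡ : ∀ c → vec 1ℚ s e c ≡ comb t (rows 1ℚ s S) c) where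
      open InsideH inside

      h : List Row
      h = e ∷ S

      ω : Vector (length h)
      ω = relation t

      ω-relation : ∀ c → comb ω (rows 1ℚ s h) c ≡ 0ℚ
      ω-relation = relation-comb (rows 1ℚ s h) {t} e≡

      inHᵢ : ∀ i → InH (lookup h i)
      inHᵢ i = inH (∈-lookup {xs = h} i)

      -- The first-order coefficient, in direction d, of the relation ω paired with the kernel
      -- vector.
      derivative : Framework → ℚ
      derivative d = sum λ i → ω i * rows 0ℚ d h i ∙ x

      improveAlong : ∀ d → derivative d ≢ 0ℚ → Improvement s
      improveAlong d d≢0 = improve gp d h short (λ ind → ℚP.1≢0 (ind ω ω-relation zero))
        (near-move s d h (near-improve {r = rows 1ℚ s h} (rows 0ℚ d h) {ω} (dual⇒indep {r = rows 1ℚ s S} dual) refl ω-relation x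
          (λ i → trans (vec-∙ 1ℚ s (lookup h i) x) (killed (inHᵢ i))) d≢0))

      -- The c-th unit motion turned by a right angle. On a class `X` is itself a turned and scaled
      -- copy of the positions, so the two rotations cancel in the derivative.
      spin : Fin (n G +ℕ n G) → Framework
      spin c = framework (λ v → perp (pt (δ c) v)) (λ _ → origin)

      turn : Fin (m G) → Bool → Framework
      turn l b = framework (λ _ → origin) (single l (unit b))

      -- A relation that no direction removes must vanish

      module Stuck (spin≡0 : ∀ c → derivative (spin c) ≡ 0ℚ) (turn≡0 : ∀ l b → derivative (turn l b) ≡ 0ℚ) where

        derivative-eval : ∀ d → derivative d ≡ 0ℚ → sum (λ i → ω i * eval 0ℚ d (lookup h i) X) ≡ 0ℚ
        derivative-eval d e = trans (sum-cong-≗ λ i → cong (ω i *_) (sym (vec-∙ 0ℚ d (lookup h i) x))) e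

        equilibrium : ∀ z → sum (λ i → ω i * eval 1ℚ s (lookup h i) z) ≡ 0ℚ
        equilibrium z = trans (sum-cong-≗ λ i → cong (ω i *_) (sym (vec-∙-flat 1ℚ s (lookup h i) z)))
          (trans (sym (∙-combˡ ω (rows 1ℚ s h) (flat z))) (∙-zeroˡ (flat z) ω-relation))

        isolate : ∀ i (f : Fin (length h) → ℚ) → sum (λ j → ω j * f j) ≡ 0ℚ → (∀ j → j ≢ i → ω j * f j ≡ 0ℚ) → f i ≢ 0ℚ → ω i ≡ 0ℚ
        isolate i f total off fi≢0 = *≡0⇒≡0 fi≢0 (trans (ℚP.*-comm (f i) (ω i)) (trans (sym (sum-single i off)) total))

        distinct : ∀ {i j r} → j ≢ i → lookup h i ≡ r → lookup h j ≢ r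
        distinct j≢i ei ej = j≢i (lookup-injective unique (trans ej (sym ei)))

        turn-off : ∀ {l b} r → r ≢ loop l → eval 0ℚ (turn l b) r X ≡ 0ℚ
        turn-off (edge u v) _ = origin-· (X u ⊖ X v)
        turn-off {b = b} (loop l′) ne = trans (cong (_· X (loopAt G l′)) (single-≢ {w = l′} (unit b) λ { refl → ne refl })) (origin-· (X (loopAt G l′)))
        turn-off (pin v b) _ = ℚP.*-zeroˡ (coord b (X v))

        -- Changing `q` at l alone affects no other row, so the vanishing derivative is `ω i` times
        -- one coordinate of `X` at the vertex of l.
        ω-loop-via : ∀ i {l} b → lookup h i ≡ loop l → unit b · X (loopAt G l) ≢ 0ℚ → ω i ≡ 0ℚ
        ω-loop-via i {l} b ei ne = isolate i (λ j → eval 0ℚ (turn l b) (lookup h j) X) (derivative-eval (turn l b) (turn≡0 l b))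
          (λ j j≢i → *-zero₂ (ω j) (turn-off (lookup h j) (distinct j≢i ei)))
          (λ z → ne (trans (cong (_· X (loopAt G l)) (sym (single-≡ l (unit b)))) (trans (cong (λ r → eval 0ℚ (turn l b) r X) (sym ei)) z)))

        ω-loop : ∀ i {l} → lookup h i ≡ loop l → ω i ≡ 0ℚ
        ω-loop i {l} ei with subst InH ei (inHᵢ i)
        ... | loopᴴ nz with X₁ (loopAt G l) ≟ 0ℚ
        ...   | no ne  = ω-loop-via i false ei λ z → ne (trans (sym (unit-·₁ (X (loopAt G l)))) z)
        ...   | yes z₁ = ω-loop-via i true ei λ z → nz (cong₂ _,_ z₁ (trans (sym (unit-·₂ (X (loopAt G l)))) z))

        -- The angular velocity of the class of an edge. The value 0 at loops and pins matches their
        -- zero derivative under every `spin`.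
        slope : Row → ℚ
        slope (edge v u) = proj₁ (classOf v u)
        slope _          = 0ℚ

        slope-edge : ∀ {κ v u} → (v , u) ∈ triangulate (members κ) → slope (edge v u) ≡ proj₁ κ
        slope-edge {κ} {v} {u} vu∈ with triangulated-in {κ} vu∈
        ... | iv , iu , v≢u = cong proj₁ (in-unique v≢u (in-classOf₁ v u) (in-classOf₂ v≢u (edge-killed iv iu)) iv iu)

        -- For an edge both factors of the inner product are rotated by the same right angle, which
        -- leaves the original row scaled by the angular velocity.
        spin-eval : ∀ c {r} → InH r → eval 0ℚ (spin c) r X ≡ slope r * vec 1ℚ s r c
        spin-eval c (pinᴴ {v} {b} _) = trans (ℚP.*-zeroˡ (coord b (X v))) (sym (ℚP.*-zeroˡ (vec 1ℚ s (pin v b) c)))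
        spin-eval c (loopᴴ {l} _) = trans (origin-· (X (loopAt G l))) (sym (ℚP.*-zeroˡ (vec 1ℚ s (loop l) c)))
        spin-eval c (edgeᴴ {κ} {v} {u} κ∈ vu∈) with triangulated-in {κ} vu∈
        ... | iv , iu , _ = trans (cong₂ (λ a b → proj₁ (perp (D v) ⊖ perp (D u)) * a + proj₂ (perp (D v) ⊖ perp (D u)) * b) (diff₁ iv iu) (diff₂ iv iu))
            (trans (lemma (proj₁ κ) (p₁ v - p₁ u) (p₂ v - p₂ u) (proj₁ (D v)) (proj₂ (D v)) (proj₁ (D u)) (proj₂ (D u)))
              (cong (_* vec 1ℚ s (edge v u) c) (sym (slope-edge {κ} vu∈))))
          where
          D : Motion
          D = pt (δ c)
          lemma : ∀ a x y d₁ d₂ e₁ e₂ → (d₂ - e₂) * (a * y) + (- d₁ - - e₁) * (- (a * x)) ≡ a * (x * (d₁ - e₁) + y * (d₂ - e₂))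
          lemma = solve-∀ ℚ-ring

        μ : Vector (length h)
        μ i = ω i * slope (lookup h i)

        -- Rotating the first-order condition by a right angle turns it into a second relation.
        μ-relation : ∀ c → comb μ (rows 1ℚ s h) c ≡ 0ℚ
        μ-relation c = trans (sum-cong-≗ λ i → trans (ℚP.*-assoc (ω i) (slope (lookup h i)) (vec 1ℚ s (lookup h i) c))
          (cong (ω i *_) (sym (spin-eval c (inHᵢ i))))) (derivative-eval (spin c) (spin≡0 c))

        -- Relations of `h` form a line spanned by ω, so μ is a multiple of ω; the factor is
        -- `μ zero` because `ω zero` is 1.
        slope-constant : ∀ i → ω i ≢ 0ℚ → slope (lookup h i) ≡ μ zero
        slope-constant i ωi≢0 = -≡0⇒≡ (*≡0⇒≡0 ωi≢0 (trans (lemma (ω i) (slope (lookup h i)) (μ zero))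
          (≡⇒-≡0 (relation-unique {r = rows 1ℚ s h} {ω} (dual⇒indep {r = rows 1ℚ s S} dual) refl ω-relation μ μ-relation i))))
          where
          lemma : ∀ w a b → w * (a - b) ≡ w * a - b * w
          lemma = solve-∀ ℚ-ring

        class-slope : ∀ i {κ v u} → lookup h i ≡ edge v u → (v , u) ∈ triangulate (members κ) → ω i ≢ 0ℚ → proj₁ κ ≡ μ zero
        class-slope i {κ} ei vu∈ ωi≢0 = trans (sym (slope-edge {κ} vu∈)) (trans (cong slope (sym ei)) (slope-constant i ωi≢0))

        single-far : ∀ {w v u} d → v ≢ w → u ≢ w → eval 1ℚ s (edge v u) (single w d) ≡ 0ℚ
        single-far {w} {v} {u} d v≢w u≢w = trans (cong₂ (λ a b → (p s v ⊖ p s u) · (a ⊖ b)) (single-≢ d v≢w) (single-≢ d u≢w)) (·-origin (p s v ⊖ p s u))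

        single-at : ∀ {v u} d → u ≢ v → eval 1ℚ s (edge v u) (single v d) ≡ (p s v ⊖ p s u) · d
        single-at {v} {u} d u≢v = cong ((p s v ⊖ p s u) ·_) (trans (cong₂ _⊖_ (single-≡ v d) (single-≢ d u≢v)) (⊖-origin d))

        pin-far : ∀ {w v} b d → v ≢ w → eval 1ℚ s (pin v b) (single w d) ≡ 0ℚ
        pin-far false d v≢w = *-zero₂ 1ℚ (cong proj₁ (single-≢ d v≢w))
        pin-far true  d v≢w = *-zero₂ 1ℚ (cong proj₂ (single-≢ d v≢w))

        -- Two classes of equal slope are disjoint, so at a vertex of κ only edges of κ carry stress.
        only-class : ∀ {κ w d i} → κ ∈ 𝒞 → In κ w → ¬ In zeroClass w → proj₁ κ ≡ μ zero →
          (∀ j {v u} → j ≢ i → lookup h j ≡ edge v u → (v , u) ∈ triangulate (members κ) → w ≡ v ⊎ w ≡ u →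
            ω j * eval 1ℚ s (edge v u) (single w d) ≡ 0ℚ) →
          ∀ j → j ≢ i → ω j * eval 1ℚ s (lookup h j) (single w d) ≡ 0ℚ
        only-class {κ} {w} {d} {i} κ∈ w∈κ w-nonzero slope-κ own j j≢i = go (lookup h j) refl (inHᵢ j)
          where
          go : ∀ r → lookup h j ≡ r → InH r → ω j * eval 1ℚ s r (single w d) ≡ 0ℚ
          go (pin v b) ej (pinᴴ z) = *-zero₂ (ω j) (pin-far b d λ { refl → w-nonzero z })
          go (loop l)  ej (loopᴴ _) = *-zero₁ (eval 1ℚ s (loop l) (single w d)) (ω-loop j ej)
          go (edge v u) ej (edgeᴴ {κ′} κ′∈ vu∈) with ω j ≟ 0ℚ | w ≟F v | w ≟F u
          ... | yes z | _ | _ = *-zero₁ (eval 1ℚ s (edge v u) (single w d)) z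
          ... | no _  | no w≢v | no w≢u = *-zero₂ (ω j) (single-far d (λ e → w≢v (sym e)) (λ e → w≢u (sym e)))
          ... | no nz | yes w≡v | _ = own j j≢i ej (subst (λ κ → (v , u) ∈ triangulate (members κ)) κ′≡κ vu∈) (inj₁ w≡v)
            where
            κ′≡κ : κ′ ≡ κ
            κ′≡κ = same-slope (trans (class-slope j {κ′} ej vu∈ nz) (sym slope-κ)) (subst (In κ′) (sym w≡v) (proj₁ (triangulated-in {κ′} vu∈))) w∈κ
          ... | no nz | no _ | yes w≡u = own j j≢i ej (subst (λ κ → (v , u) ∈ triangulate (members κ)) κ′≡κ vu∈) (inj₂ w≡u)
            where
            κ′≡κ : κ′ ≡ κ
            κ′≡κ = same-slope (trans (class-slope j {κ′} ej vu∈ nz) (sym slope-κ)) (subst (In κ′) (sym w≡u) (proj₁ (proj₂ (triangulated-in {κ′} vu∈)))) w∈κ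

        module _ {κ a b rest} (κ∈ : κ ∈ 𝒞) (eq : members κ ≡ a ∷ b ∷ rest) where

          list-unique : Unique (a ∷ b ∷ rest)
          list-unique = subst Unique eq (members-unique κ)

          a≢b : a ≢ b
          a≢b = All.lookup (AllPairs.head list-unique) (here refl)

          a≢ : ∀ {v} → v ∈ rest → a ≢ v
          a≢ v∈ = All.lookup (AllPairs.head list-unique) (there v∈)

          b≢ : ∀ {v} → v ∈ rest → b ≢ v
          b≢ v∈ = All.lookup (AllPairs.head (AllPairs.tail list-unique)) v∈

          in-κ : ∀ {v} → v ∈ a ∷ b ∷ rest → In κ v
          in-κ v∈ = members-in (subst (_ ∈_) (sym eq) v∈)

          view : ∀ {v u} → (v , u) ∈ triangulate (members κ) → (v ≡ b × u ≡ a) ⊎ (v ∈ rest × (u ≡ a ⊎ u ≡ b))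
          view {v} {u} vu∈ with ∈-triangulate (a ∷ b ∷ rest) (subst (λ xs → (v , u) ∈ triangulate xs) eq vu∈)
          ... | _ , _ , _ , refl , h = h

          -- A fan vertex v has only two edges inside its class, to `u` and `u′`. Moving v
          -- orthogonally to the edge to `u′` leaves the edge to `u` as the only row that responds,
          -- with a factor nonzero by noncollinearity.
          ω-fan-via : ∀ i {v u} u′ → lookup h i ≡ edge v u → (v , u) ∈ triangulate (members κ) → v ∈ rest → u ≢ v → u′ ≢ v → u ≢ u′ →
            (∀ {w} → w ≡ a ⊎ w ≡ b → w ≡ u ⊎ w ≡ u′) → ω i ≡ 0ℚ
          ω-fan-via i {v} {u} u′ ei vu∈ v∈ u≢v u′≢v u≢u′ ab with ω i ≟ 0ℚ
          ... | yes z = z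
          ... | no nz = isolate i (λ j → eval 1ℚ s (lookup h j) (single v d)) (equilibrium (single v d))
              (only-class κ∈ (in-κ (there (there v∈))) (later-nonzero κ∈ eq (there v∈)) (class-slope i {κ} ei vu∈ nz) own)
              (λ z → noncollinear gp (λ e → u≢v (sym e)) (λ e → u′≢v (sym e)) u≢u′
                (trans (sym (·-perp (p s v ⊖ p s u) (p s v ⊖ p s u′))) (trans (sym (single-at d u≢v))
                  (trans (cong (λ r → eval 1ℚ s r (single v d)) (sym ei)) z))))
            where
            d : Pt
            d = perp (p s v ⊖ p s u′)
            own : ∀ j {v₁ u₁} → j ≢ i → lookup h j ≡ edge v₁ u₁ → (v₁ , u₁) ∈ triangulate (members κ) → v ≡ v₁ ⊎ v ≡ u₁ →
              ω j * eval 1ℚ s (edge v₁ u₁) (single v d) ≡ 0ℚ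
            own j {v₁} {u₁} j≢i ej e∈ v≡ with view e∈ | v≡
            ... | inj₁ (v₁≡b , _) | inj₁ v≡v₁ = contradiction (sym (trans v≡v₁ v₁≡b)) (b≢ v∈)
            ... | inj₁ (_ , u₁≡a) | inj₂ v≡u₁ = contradiction (sym (trans v≡u₁ u₁≡a)) (a≢ v∈)
            ... | inj₂ (_ , inj₁ u₁≡a) | inj₂ v≡u₁ = contradiction (sym (trans v≡u₁ u₁≡a)) (a≢ v∈)
            ... | inj₂ (_ , inj₂ u₁≡b) | inj₂ v≡u₁ = contradiction (sym (trans v≡u₁ u₁≡b)) (b≢ v∈)
            ... | inj₂ (_ , u₁≡) | inj₁ refl with ab u₁≡
            ...   | inj₁ refl = contradiction ej (distinct j≢i ei)
            ...   | inj₂ refl = *-zero₂ (ω j) (trans (single-at d u′≢v) (perp-· (p s v ⊖ p s u′)))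

          ω-fan : ∀ i {v u} → lookup h i ≡ edge v u → (v , u) ∈ triangulate (members κ) → v ∈ rest → u ≡ a ⊎ u ≡ b → ω i ≡ 0ℚ
          ω-fan i ei vu∈ v∈ (inj₁ refl) = ω-fan-via i b ei vu∈ v∈ (a≢ v∈) (b≢ v∈) a≢b id
          ω-fan i ei vu∈ v∈ (inj₂ refl) = ω-fan-via i a ei vu∈ v∈ (b≢ v∈) (a≢ v∈) (λ e → a≢b (sym e)) Sum.swap

          -- With the fan edges free of stress, the base is the only stressed edge left at b. The
          -- test uses b and not a, since a may lie in Z and carry pins.
          ω-base : ∀ i → lookup h i ≡ edge b a → (b , a) ∈ triangulate (members κ) → ω i ≡ 0ℚ
          ω-base i ei ba∈ with ω i ≟ 0ℚ
          ... | yes z = z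
          ... | no nz = isolate i (λ j → eval 1ℚ s (lookup h j) (single b d)) (equilibrium (single b d))
              (only-class κ∈ (in-κ (there (here refl))) (later-nonzero κ∈ eq (here refl)) (class-slope i {κ} ei ba∈ nz) own)
              (λ z → separated gp (λ e → a≢b (sym e)) (trans (sym (lemma (p₁ b - p₁ a) (p₂ b - p₂ a)))
                (trans (sym (single-at d a≢b)) (trans (cong (λ r → eval 1ℚ s r (single b d)) (sym ei)) z))))
            where
            d : Pt
            d = unit false
            lemma : ∀ x y → x * 1ℚ + y * 0ℚ ≡ x
            lemma = solve-∀ ℚ-ring
            own : ∀ j {v₁ u₁} → j ≢ i → lookup h j ≡ edge v₁ u₁ → (v₁ , u₁) ∈ triangulate (members κ) → b ≡ v₁ ⊎ b ≡ u₁ →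
              ω j * eval 1ℚ s (edge v₁ u₁) (single b d) ≡ 0ℚ
            own j {v₁} {u₁} j≢i ej e∈ _ with view e∈
            ... | inj₁ (refl , refl) = contradiction ej (distinct j≢i ei)
            ... | inj₂ (v₁∈ , u₁≡)   = *-zero₁ (eval 1ℚ s (edge v₁ u₁) (single b d)) (ω-fan j ej e∈ v₁∈ u₁≡)

        ω-edge : ∀ i {v u} → lookup h i ≡ edge v u → ω i ≡ 0ℚ
        ω-edge i ei with subst InH ei (inHᵢ i)
        ... | edgeᴴ {κ} κ∈ vu∈ with ∈-triangulate (members κ) vu∈
        ...   | a , b , rest , eq , inj₁ (refl , refl) = ω-base κ∈ eq i ei vu∈
        ...   | a , b , rest , eq , inj₂ (v∈ , u≡)     = ω-fan κ∈ eq i ei vu∈ v∈ u≡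

        -- Pins come last: once loops and edges are known to carry no stress, distinct pins are
        -- distinct coordinate functionals.
        ω-pin : ∀ i {v b} → lookup h i ≡ pin v b → ω i ≡ 0ℚ
        ω-pin i {v} {b} ei = isolate i (λ j → eval 1ℚ s (lookup h j) z) (equilibrium z)
          (λ j j≢i → off j j≢i (lookup h j) refl)
          (λ e → at b ei e)
          where
          z : Motion
          z = single v (unit b)
          at : ∀ b → lookup h i ≡ pin v b → eval 1ℚ s (lookup h i) (single v (unit b)) ≢ 0ℚ
          at false ei e = ℚP.1≢0 (trans (cong (λ d → 1ℚ * proj₁ d) (sym (single-≡ v (unit false)))) (trans (cong (λ r → eval 1ℚ s r (single v (unit false))) (sym ei)) e))
          at true  ei e = ℚP.1≢0 (trans (cong (λ d → 1ℚ * proj₂ d) (sym (single-≡ v (unit true)))) (trans (cong (λ r → eval 1ℚ s r (single v (unit true))) (sym ei)) e))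
          other : ∀ b b′ → b′ ≢ b → eval 1ℚ s (pin v b′) (single v (unit b)) ≡ 0ℚ
          other false true  _ = *-zero₂ 1ℚ (cong proj₂ (single-≡ v (unit false)))
          other true  false _ = *-zero₂ 1ℚ (cong proj₁ (single-≡ v (unit true)))
          other false false ne = contradiction refl ne
          other true  true  ne = contradiction refl ne
          off : ∀ j → j ≢ i → ∀ r → lookup h j ≡ r → ω j * eval 1ℚ s r z ≡ 0ℚ
          off j j≢i (edge u w) ej = *-zero₁ (eval 1ℚ s (edge u w) z) (ω-edge j ej)
          off j j≢i (loop l)   ej = *-zero₁ (eval 1ℚ s (loop l) z) (ω-loop j ej)
          off j j≢i (pin w b′) ej = *-zero₂ (ω j) (cases (w ≟F v))
            where
            cases : Dec (w ≡ v) → eval 1ℚ s (pin w b′) z ≡ 0ℚ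
            cases (no w≢v)   = pin-far b′ (unit b) w≢v
            cases (yes refl) = other b b′ λ { refl → distinct j≢i ei ej }

        absurd : ⊥
        absurd = ℚP.1≢0 (ω₀ (lookup h zero) refl)
          where
          ω₀ : ∀ r → lookup h zero ≡ r → ω zero ≡ 0ℚ
          ω₀ (edge u v) e = ω-edge zero e
          ω₀ (loop l)   e = ω-loop zero e
          ω₀ (pin v b)  e = ω-pin zero e

      improvement : Improvement s
      improvement with all? (λ c → derivative (spin c) ≟ 0ℚ) | all? (λ l → derivative (turn l false) ≟ 0ℚ) | all? (λ l → derivative (turn l true) ≟ 0ℚ)
      ... | no ¬all | _ | _ = let c , ne = ¬∀⟶∃¬ _ _ (λ c → derivative (spin c) ≟ 0ℚ) ¬all in improveAlong (spin c) ne
      ... | yes _ | no ¬all | _ = let l , ne = ¬∀⟶∃¬ _ _ (λ l → derivative (turn l false) ≟ 0ℚ) ¬all in improveAlong (turn l false) ne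
      ... | yes _ | yes _ | no ¬all = let l , ne = ¬∀⟶∃¬ _ _ (λ l → derivative (turn l true) ≟ 0ℚ) ¬all in improveAlong (turn l true) ne
      ... | yes D | yes L₀ | yes L₁ = ⊥-elim (Stuck.absurd D λ { l false → L₀ l ; l true → L₁ l })

    -- Cutting at exactly 2|V| rows serves two ends: if independent, these rows admit no common
    -- nonzero kernel vector, and every sublist found by `scan` is short enough to be counted in the
    -- termination measure.
    H′ : List Row
    H′ = take (n G +ℕ n G) H

    H′-length : length H′ ≡ n G +ℕ n G
    H′-length = trans (length-take (n G +ℕ n G) H) (ℕP.m≤n⇒m⊓n≡m H-long)

    improvement : Improvement s
    improvement = [ spanning , dependent ]′ (scan s InsideH insideH-tail H′ H′-inside)
      where
      H′-inside : InsideH H′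
      H′-inside = record
        { unique = UniqueP.take⁺ (n G +ℕ n G) H-unique
        ; inH    = H-inH ∘ ∈-take (n G +ℕ n G)
        ; short  = ℕP.≤-reflexive H′-length }
      spanning : Dual (rows 1ℚ s H′) → Improvement s
      spanning dual = contradiction (subst (λ k → suc k ≤ℕ n G +ℕ n G) H′-length
        (commonKernel⇒< {r = rows 1ℚ s H′} dual x nonzero λ i →
          trans (vec-∙ 1ℚ s (lookup H′ i) x) (killed (InsideH.inH H′-inside (∈-lookup {xs = H′} i))))) (ℕP.<-irrefl refl)
      dependent : (Σ Row λ e → Σ (List Row) λ S → InsideH (e ∷ S) × Dual (rows 1ℚ s S) ×
        Σ (Vector (length S)) λ t → ∀ c → vec 1ℚ s e c ≡ comb t (rows 1ℚ s S) c) → Improvement s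
      dependent (e , S , inside , dual , t , e≡) = Relation.improvement e S inside dual t e≡

theorem1p5 : (G : LoopedGraph) → Balanced 6 G → Rigid G
theorem1p5 G bal = climb
  (λ s gp → Sum.map₂ (Motions.improvement bal s gp) (fullRank? s))
  momentCurve momentCurve-generalPosition
  where open Frameworks G
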